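{- For all integers $r,t$ with $3\le t\le r$, we have $f_t(r,r)=\rho_t\big(T_r(r+1)\big)$, where $T_r(r+1)$ is $K_{r+1}$ minus an edge.
   Context: All graphs are finite and simple. For integers $\Delta,\omega$, let $\mathcal{G}(\Delta,\omega)$ be the class of graphs $G$ with maximum degree $\Delta(G)\le\Delta$ and clique number $\omega(G)\le\omega$. For a graph $G$, $k_t(G)$ denotes the number of copies of $K_t$ in $G$, and $\rho_t(G)=k_t(G)/|V(G)|$. For a positive integer $n$ let $k_t(n,\Delta,\omega)=\max\{k_t(G): |V(G)|=n,\ G\in\mathcal{G}(\Delta,\omega)\}$, and define $f_t(\Delta,\omega)=\lim_{n\to\infty}k_t(n,\Delta,\omega)/n$ (this limit exists and equals $\sup_{n}k_t(n,\Delta,\omega)/n$). $T_r(n)$ denotes the Turán graph: the complete $r$-partite graph on $n$ vertices whose part sizes differ by at most one. -}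

module Defs where

open import Data.Bool using (Bool; true; false; _∧_; _∨_; not; T)
open import Data.Nat using (ℕ; zero; suc; _≤_; _≡ᵇ_; NonZero)
open import Data.Nat.DivMod using (_%_)
open import Data.Fin using (Fin; toℕ; _≟_)
open import Data.Fin.Subset using (Subset; _∈_; ∣_∣; inside; outside)
open import Data.Vec using (_∷_; []; lookup)
open import Data.List using (List; []; _∷_; map; _++_; length; filterᵇ; foldr; allFin)
open import Relation.Nullary using (¬_)
open import Relation.Nullary.Decidable using (⌊_⌋)
open import Relation.Binary.PropositionalEquality using (_≡_; _≢_)

record Graph (n : ℕ) : Set where
  field
    adj   : Fin n → Fin n → Bool
    sym   : ∀ i j → adj i j ≡ adj j i
    irref : ∀ i → adj i i ≡ false
open Graph public

Adj : ∀ {n} → Graph n → Fin n → Fin n → Set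
Adj G i j = T (adj G i j)

degree : ∀ {n} → Graph n → Fin n → ℕ
degree {n} G v = length (filterᵇ (adj G v) (allFin n))

MaxDegree≤ : ∀ {n} → Graph n → ℕ → Set
MaxDegree≤ G Δ = ∀ v → degree G v ≤ Δ

IsClique : ∀ {n} → Graph n → Subset n → Set
IsClique G S = ∀ i j → i ∈ S → j ∈ S → i ≢ j → Adj G i j

CliqueNumber≤ : ∀ {n} → Graph n → ℕ → Set
CliqueNumber≤ G ω = ∀ S → IsClique G S → ∣ S ∣ ≤ ω

InClass : ∀ {n} → Graph n → ℕ → ℕ → Set
InClass G Δ ω = MaxDegree≤ G Δ × CliqueNumber≤ G ω
  where open import Data.Product using (_×_)

allSubsets : (n : ℕ) → List (Subset n)
allSubsets zero    = [] ∷ []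
allSubsets (suc n) = map (inside ∷_) (allSubsets n) ++ map (outside ∷_) (allSubsets n)

allᵇ : {A : Set} → (A → Bool) → List A → Bool
allᵇ p = foldr (λ x b → p x ∧ b) true

isCliqueᵇ : ∀ {n} → Graph n → Subset n → Bool
isCliqueᵇ {n} G S =
  allᵇ (λ i → allᵇ (λ j → not (lookup S i ∧ lookup S j ∧ not ⌊ i ≟ j ⌋) ∨ adj G i j) (allFin n)) (allFin n)

k : ∀ {n} → ℕ → Graph n → ℕ
k {n} t G = length (filterᵇ (λ S → (∣ S ∣ ≡ᵇ t) ∧ isCliqueᵇ G S) (allSubsets n))

-- Turán graph T_r(n): vertex i lies in part (i mod r); two vertices are adjacent iff
-- they lie in different parts. Part sizes differ by at most one.
turán : (r n : ℕ) → .{{NonZero r}} → Graph n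
turán r n = record { adj = a ; sym = s ; irref = ir }
  where
  open import Relation.Binary.PropositionalEquality using (refl)
  a : Fin n → Fin n → Bool
  a i j = not (toℕ i % r ≡ᵇ toℕ j % r)
  s : ∀ i j → a i j ≡ a j i
  s i j with toℕ i % r | toℕ j % r
  ... | x | y = lemma x y
    where
    lemma : ∀ x y → not (x ≡ᵇ y) ≡ not (y ≡ᵇ x)
    lemma zero zero = refl
    lemma zero (suc y) = refl
    lemma (suc x) zero = refl
    lemma (suc x) (suc y) = lemma x y
  ir : ∀ i → a i i ≡ false
  ir i = lemma (toℕ i % r)
    where
    lemma : ∀ x → not (x ≡ᵇ x) ≡ false
    lemma zero = refl
    lemma (suc x) = lemma x

{-# OPTIONS --safe #-}
-- Count ordered cliques, so that k_t becomes t! k_t =: h_t and binomials become falling factorials.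
-- Writing h⁻_t for the count in K_{r+1} minus an edge, h⁻_{t+1} = (r - t) h⁻_t + (r - 1)(r - 2)⋯(r - t),
-- because a t-clique of that graph has r - t common neighbours, or r + 1 - t if it avoids both
-- non-adjacent vertices. In any G of the class, an ordered t-clique has at most r - t common
-- neighbours unless it lies in a class C of vertices sharing one closed neighbourhood of size r + 1;
-- since G contains no K_{r+1}, such a class has at most r - 1 elements. For t ≥ 3 the number of
-- ordered t-cliques inside these classes is at most (r - 1)⋯(r - t) n/(r + 1): only the classes of
-- size r - 1 exceed the average, and each is paid for by the remaining two vertices of its closed
-- neighbourhood. This gives the step t → t + 1.
--
-- For triangles, let B be the closed neighbourhood of a vertex v of degree r, C ⊆ B its class, and
-- s_a = r - |N(a) ∩ B| for a ∈ B. The neighbourhood of each x ∈ C lacks at least σ = Σ s_a of the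
-- r(r - 1) possible ordered edges, and that of each a ∈ B \ C lacks at least 2|C| s_a. So B lacks
-- 3|C|σ in total, which is at least the required 6(r - 1) whenever v itself lacks fewer than the
-- average 6(r - 1)/(r + 1); and the sets B of such vertices v are pairwise equal or disjoint.
module Submission where

open import Defs renaming (sym to adj-sym)
import Algebra.Properties.Semiring.Sum
open import Data.Bool as Bool using (Bool; true; false; _∧_; _∨_; not)
open import Data.Bool.Properties
  using (∧-conicalˡ; ∧-conicalʳ; ¬-not; T-≡; ⇔→≡; ∧-identityʳ; ∧-zeroʳ; ∨-zeroʳ)
open import Data.Empty using (⊥)
open import Data.Fin using (Fin; zero; suc; _≟_; fromℕ; toℕ)
open import Data.Fin.Properties using (any?; toℕ-injective; toℕ-fromℕ; toℕ≤pred[n])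
open import Data.Fin.Subset using (Subset; ∣_∣)
import Data.Integer as ℤ
import Data.Integer.Properties as ℤ
open import Data.List using ([]; _∷_; map; _++_; length; filterᵇ; tabulate; allFin)
open import Data.Nat as ℕ
  using (ℕ; zero; suc; _+_; _*_; _∸_; _≤_; _<_; z≤n; s≤s; _≡ᵇ_; _!; NonZero; >-nonZero⁻¹; ≢-nonZero⁻¹)
open import Data.Nat.DivMod using (_%_; m<n⇒m%n≡m; n%n≡0)
open import Data.Nat.Properties hiding (_≟_)
open import Data.Nat.Tactic.RingSolver using (solve-∀)
open import Data.Product using (_×_; _,_; ∃; proj₁; proj₂)
open import Data.Rational as ℚ using (ℚ; _/_)
import Data.Rational.Properties as ℚ
open import Data.Rational.Unnormalised using (mkℚᵘ; *≤*)
import Data.Rational.Unnormalised.Properties as ℚᵘ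
open import Data.Sum using (_⊎_; inj₁; inj₂)
open import Data.Vec as Vec using ([]; _∷_; lookup; _[_]≔_)
open import Data.Vec.Properties
  using (lookup∘update; lookup∘update′; lookup∘tabulate; []=⇒lookup; lookup⇒[]=)
open import Function using (_∘_; id; _⇔_; mk⇔; Equivalence)
open import Relation.Binary.PropositionalEquality
  using (_≡_; _≢_; refl; sym; trans; cong; cong₂; subst; subst₂; module ≡-Reasoning)
open import Relation.Nullary using (¬_; Dec; yes; no; contradiction)
open import Relation.Nullary.Decidable using (⌊_⌋)

open Algebra.Properties.Semiring.Sum +-*-semiring
  using (sum; sum-cong-≗; ∑-distrib-+; *-distribˡ-sum; *-distribʳ-sum)

-- Boolean vertex sets

private variable
  n : ℕ

-- With sets as Boolean predicates, a row `adj G v` is itself a set and membership is an equation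
-- that can be rewritten with.
BSet : ℕ → Set
BSet n = Fin n → Bool

infix 4 _∈_ _∉_ _⊆_
infixr 7 _∩_ _∖_

_∈_ _∉_ : Fin n → BSet n → Set
x ∈ P = P x ≡ true
x ∉ P = P x ≡ false

_⊆_ : BSet n → BSet n → Set
P ⊆ Q = ∀ x → x ∈ P → x ∈ Q

Disjoint : BSet n → BSet n → Set
Disjoint P Q = ∀ x → x ∈ P → x ∉ Q

full : BSet n
full _ = true

only : Fin n → BSet n
only v x = ⌊ v ≟ x ⌋

_∩_ _∖_ : BSet n → BSet n → BSet n
(P ∩ Q) x = P x ∧ Q x
(P ∖ Q) x = P x ∧ not (Q x)

true≢false : ∀ {b} {A : Set} → b ≡ true → b ≡ false → A
true≢false refl ()

∧-intro : ∀ {a b} → a ≡ true → b ≡ true → a ∧ b ≡ true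
∧-intro = cong₂ _∧_

∧-proj₁ : ∀ {a b} → a ∧ b ≡ true → a ≡ true
∧-proj₁ = ∧-conicalˡ _ _

∧-proj₂ : ∀ {a b} → a ∧ b ≡ true → b ≡ true
∧-proj₂ = ∧-conicalʳ _ _

not-intro : ∀ {b} → b ≡ false → not b ≡ true
not-intro = cong not

not-elim : ∀ {b} → not b ≡ true → b ≡ false
not-elim {false} _ = refl

m≤m*m : ∀ m → m ≤ m * m
m≤m*m zero    = z≤n
m≤m*m (suc m) = m≤m*n (suc m) (suc m)

⌊⌋-intro : ∀ {A : Set} (A? : Dec A) → A → ⌊ A? ⌋ ≡ true
⌊⌋-intro (yes _) a = refl
⌊⌋-intro (no ¬a) a = contradiction a ¬a

⌊⌋-elim : ∀ {A : Set} (A? : Dec A) → ⌊ A? ⌋ ≡ true → A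
⌊⌋-elim (yes a) _ = a

∈-only : (v : Fin n) → v ∈ only v
∈-only v with v ≟ v
... | yes _ = refl
... | no v≢v = contradiction refl v≢v

only⇒≡ : {v x : Fin n} → x ∈ only v → v ≡ x
only⇒≡ {v = v} {x} e with v ≟ x
... | yes p = p

∉-only : {v x : Fin n} → v ≢ x → x ∉ only v
∉-only {v = v} {x} v≢x with v ≟ x
... | yes p = contradiction p v≢x
... | no _ = refl

∉-only⇒≢ : {v x : Fin n} → x ∉ only v → v ≢ x
∉-only⇒≢ e refl = true≢false (∈-only _) e

-- Cardinalities and sums over vertex sets

⟦_⟧ : Bool → ℕ
⟦ true ⟧ = 1
⟦ false ⟧ = 0

# : BSet n → ℕ
# P = sum (λ x → ⟦ P x ⟧)

sumIn : BSet n → (Fin n → ℕ) → ℕ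
sumIn P f = sum (λ x → ⟦ P x ⟧ * f x)

sum-mono : {f g : Fin n → ℕ} → (∀ x → f x ≤ g x) → sum f ≤ sum g
sum-mono {zero}  f≤g = z≤n
sum-mono {suc n} f≤g = +-mono-≤ (f≤g zero) (sum-mono (f≤g ∘ suc))

sum-zero : {f : Fin n → ℕ} → (∀ x → f x ≡ 0) → sum f ≡ 0
sum-zero {zero}  f≡0 = refl
sum-zero {suc n} f≡0 = cong₂ _+_ (f≡0 zero) (sum-zero (f≡0 ∘ suc))

sumIn-mono : ∀ (P : BSet n) {f g} → (∀ x → x ∈ P → f x ≤ g x) → sumIn P f ≤ sumIn P g
sumIn-mono P {f} {g} h = sum-mono pointwise
  where
  pointwise : ∀ x → ⟦ P x ⟧ * f x ≤ ⟦ P x ⟧ * g x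
  pointwise x with P x in e
  ... | true  = *-monoʳ-≤ 1 (h x e)
  ... | false = z≤n

sumIn-const : ∀ (P : BSet n) c → sumIn P (λ _ → c) ≡ # P * c
sumIn-const P c = sym (*-distribʳ-sum c (λ x → ⟦ P x ⟧))

sumIn-+ : ∀ (P : BSet n) f g → sumIn P (λ x → f x + g x) ≡ sumIn P f + sumIn P g
sumIn-+ {n} P f g = trans (sum-cong-≗ λ x → *-distribˡ-+ ⟦ P x ⟧ (f x) (g x))
                      (∑-distrib-+ {n} _ _)

sumIn-* : ∀ (P : BSet n) c f → sumIn P (λ x → c * f x) ≡ c * sumIn P f
sumIn-* {n} P c f = trans (sum-cong-≗ λ x → swap ⟦ P x ⟧ c (f x))
                      (sym (*-distribˡ-sum {n} c _))
  where
  swap : ∀ a b d → a * (b * d) ≡ b * (a * d)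
  swap = solve-∀

sumIn-split : ∀ (P Q : BSet n) f → sumIn P f ≡ sumIn (P ∩ Q) f + sumIn (P ∖ Q) f
sumIn-split {n} P Q f = trans (sum-cong-≗ pointwise) (∑-distrib-+ {n} _ _)
  where
  pointwise : ∀ x → ⟦ P x ⟧ * f x ≡ ⟦ (P ∩ Q) x ⟧ * f x + ⟦ (P ∖ Q) x ⟧ * f x
  pointwise x with P x | Q x
  ... | true  | true  = sym (+-identityʳ _)
  ... | true  | false = refl
  ... | false | _     = refl

sumIn-∩ : ∀ (P Q : BSet n) f → sumIn P (λ x → ⟦ Q x ⟧ * f x) ≡ sumIn (P ∩ Q) f
sumIn-∩ P Q f = sum-cong-≗ pointwise
  where
  pointwise : ∀ x → ⟦ P x ⟧ * (⟦ Q x ⟧ * f x) ≡ ⟦ (P ∩ Q) x ⟧ * f x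
  pointwise x with P x
  ... | true  = *-identityˡ _
  ... | false = refl

sumIn-⊆ : ∀ (P Q : BSet n) {f} → P ⊆ Q → sumIn P f ≤ sumIn Q f
sumIn-⊆ P Q {f} P⊆Q = sum-mono pointwise
  where
  pointwise : ∀ x → ⟦ P x ⟧ * f x ≤ ⟦ Q x ⟧ * f x
  pointwise x with P x in e
  ... | true rewrite P⊆Q x e = ≤-refl
  ... | false = z≤n

sumIn-full : ∀ (f : Fin n → ℕ) → sumIn full f ≡ sum f
sumIn-full f = sum-cong-≗ λ x → *-identityˡ (f x)

sumIn-only : ∀ (v : Fin n) f → sumIn (only v) f ≡ f v
sumIn-only {suc n} zero f =
  trans (cong₂ _+_ (*-identityˡ (f zero)) (sum-zero {n} λ _ → refl)) (+-identityʳ _)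
sumIn-only (suc v) f =
  trans (sum-cong-≗ λ x → cong (λ b → ⟦ b ⟧ * f (suc x)) (only-suc x)) (sumIn-only v (f ∘ suc))
  where
  only-suc : ∀ x → only (suc v) (suc x) ≡ only v x
  only-suc x with v ≟ x
  ... | yes _ = refl
  ... | no _  = refl

#-sumIn : ∀ (P : BSet n) → sumIn P (λ _ → 1) ≡ # P
#-sumIn P = sum-cong-≗ λ x → *-identityʳ ⟦ P x ⟧

#-full : ∀ n → # (full {n}) ≡ n
#-full zero    = refl
#-full (suc n) = cong suc (#-full n)

#-only : (v : Fin n) → # (only v) ≡ 1
#-only v = trans (sym (#-sumIn (only v))) (sumIn-only v _)

#-⊆ : ∀ (P Q : BSet n) → P ⊆ Q → # P ≤ # Q
#-⊆ P Q P⊆Q = sum-mono pointwise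
  where
  pointwise : ∀ x → ⟦ P x ⟧ ≤ ⟦ Q x ⟧
  pointwise x with P x in e
  ... | true rewrite P⊆Q x e = ≤-refl
  ... | false = z≤n

#-split : ∀ (P Q : BSet n) → # P ≡ # (P ∩ Q) + # (P ∖ Q)
#-split P Q = begin
  # P                                                  ≡⟨ #-sumIn P ⟨
  sumIn P (λ _ → 1)                                    ≡⟨ sumIn-split P Q _ ⟩
  sumIn (P ∩ Q) (λ _ → 1) + sumIn (P ∖ Q) (λ _ → 1)    ≡⟨ cong₂ _+_ (#-sumIn (P ∩ Q)) (#-sumIn (P ∖ Q)) ⟩
  # (P ∩ Q) + # (P ∖ Q)                                ∎
  where open ≡-Reasoning

#-disjoint : ∀ (P Q R : BSet n) → P ⊆ R → Q ⊆ R → Disjoint P Q → # P + # Q ≤ # R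
#-disjoint P Q R P⊆R Q⊆R P∥Q = begin
  # P + # Q              ≤⟨ +-mono-≤ (#-⊆ P (R ∩ P) λ x x∈P → ∧-intro (P⊆R x x∈P) x∈P)
                                     (#-⊆ Q (R ∖ P) λ x x∈Q → ∧-intro (Q⊆R x x∈Q) (notP x x∈Q)) ⟩
  # (R ∩ P) + # (R ∖ P)  ≡⟨ #-split R P ⟨
  # R                    ∎
  where
  open ≤-Reasoning
  notP : ∀ x → x ∈ Q → not (P x) ≡ true
  notP x x∈Q with P x in e
  ... | true  = true≢false x∈Q (P∥Q x e)
  ... | false = refl

#-add : ∀ (P R : BSet n) v → P ⊆ R → v ∈ R → v ∉ P → suc (# P) ≤ # R
#-add P R v P⊆R v∈R v∉P = begin
  1 + # P              ≡⟨ cong (_+ # P) (#-only v) ⟨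
  # (only v) + # P     ≤⟨ #-disjoint (only v) P R (λ x x∈ → subst (_∈ R) (only⇒≡ x∈) v∈R) P⊆R
                            (λ x x∈ → subst (_∉ P) (only⇒≡ x∈) v∉P) ⟩
  # R                  ∎
  where open ≤-Reasoning

#-add₂ : ∀ (P R : BSet n) u v → P ⊆ R → u ∈ R → v ∈ R → u ∉ P → v ∉ P → u ≢ v → 2 + # P ≤ # R
#-add₂ P R u v P⊆R u∈R v∈R u∉P v∉P u≢v = begin
  suc (suc (# P))         ≤⟨ s≤s (#-add P (R ∖ only u) v (λ x x∈P → ∧-intro (P⊆R x x∈P)
                                (not-intro (∉-only λ { refl → true≢false x∈P u∉P })))
                                (∧-intro v∈R (not-intro (∉-only u≢v))) v∉P) ⟩
  suc (# (R ∖ only u))    ≤⟨ #-add (R ∖ only u) R u (λ x → ∧-proj₁) u∈R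
                               (trans (cong (λ b → R u ∧ not b) (∈-only u)) (∧-zeroʳ (R u))) ⟩
  # R                     ∎
  where open ≤-Reasoning

sumIn-⟦⟧ : ∀ (P Q : BSet n) c → sumIn P (λ x → ⟦ Q x ⟧ * c) ≡ # (P ∩ Q) * c
sumIn-⟦⟧ P Q c = trans (sumIn-∩ P Q (λ _ → c)) (sumIn-const (P ∩ Q) c)

#-remove : ∀ (P : BSet n) v → # P ≤ suc (# (P ∖ only v))
#-remove P v = begin
  # P                                ≡⟨ #-split P (only v) ⟩
  # (P ∩ only v) + # (P ∖ only v)    ≤⟨ +-monoˡ-≤ _ (#-⊆ (P ∩ only v) (only v) λ x → ∧-proj₂ {P x}) ⟩
  # (only v) + # (P ∖ only v)        ≡⟨ cong (_+ # (P ∖ only v)) (#-only v) ⟩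
  suc (# (P ∖ only v))               ∎
  where open ≤-Reasoning

∈⇒1≤# : ∀ (P : BSet n) {v} → v ∈ P → 1 ≤ # P
∈⇒1≤# P {v} v∈P = ≤-trans (s≤s z≤n) (#-add (λ _ → false) P v (λ _ ()) v∈P refl)

-- Subsets and cliques

allᵇ-allFin : (p : Fin n → Bool) → allᵇ p (allFin n) ≡ true ⇔ (∀ x → p x ≡ true)
allᵇ-allFin p = mk⇔ (to p id) (from p id)
  where
  to : ∀ {m n} (p : Fin n → Bool) (f : Fin m → Fin n) → allᵇ p (tabulate f) ≡ true → ∀ x → p (f x) ≡ true
  to p f h zero    = ∧-proj₁ h
  to p f h (suc x) = to p (f ∘ suc) (∧-proj₂ {p (f zero)} h) x
  from : ∀ {m n} (p : Fin n → Bool) (f : Fin m → Fin n) → (∀ x → p (f x) ≡ true) → allᵇ p (tabulate f) ≡ true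
  from {zero}  p f h = refl
  from {suc m} p f h = ∧-intro (h zero) (from p (f ∘ suc) (h ∘ suc))

length-filterᵇ-allFin : (P : BSet n) → length (filterᵇ P (allFin n)) ≡ # P
length-filterᵇ-allFin P = go P id
  where
  go : ∀ {m n} (P : BSet n) (f : Fin m → Fin n) → length (filterᵇ P (tabulate f)) ≡ # (P ∘ f)
  go {zero}  P f = refl
  go {suc m} P f with P (f zero)
  ... | true  = cong suc (go P (f ∘ suc))
  ... | false = go P (f ∘ suc)

∣∣≡#lookup : (S : Subset n) → ∣ S ∣ ≡ # (lookup S)
∣∣≡#lookup []          = refl
∣∣≡#lookup (true ∷ S)  = cong suc (∣∣≡#lookup S)
∣∣≡#lookup (false ∷ S) = ∣∣≡#lookup S

-- The recursion is that of `allSubsets`, so identities between such sums go by induction on the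
-- first coordinate, without lists.
sumSubsets : ∀ n → (Subset n → ℕ) → ℕ
sumSubsets zero    F = F []
sumSubsets (suc n) F = sumSubsets n (F ∘ (true ∷_)) + sumSubsets n (F ∘ (false ∷_))

sumSubsets-cong : ∀ n {F H} → (∀ S → F S ≡ H S) → sumSubsets n F ≡ sumSubsets n H
sumSubsets-cong zero    F≗H = F≗H []
sumSubsets-cong (suc n) F≗H =
  cong₂ _+_ (sumSubsets-cong n (F≗H ∘ (true ∷_))) (sumSubsets-cong n (F≗H ∘ (false ∷_)))

sumSubsets-* : ∀ n c F → sumSubsets n (λ S → c * F S) ≡ c * sumSubsets n F
sumSubsets-* zero    c F = refl
sumSubsets-* (suc n) c F =
  trans (cong₂ _+_ (sumSubsets-* n c _) (sumSubsets-* n c _)) (sym (*-distribˡ-+ c _ _))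

sumSubsets-∑ : ∀ n {m} (F : Fin m → Subset n → ℕ) →
  sumSubsets n (λ S → sum (λ i → F i S)) ≡ sum (λ i → sumSubsets n (F i))
sumSubsets-∑ zero    F = refl
sumSubsets-∑ (suc n) {m} F =
  trans (cong₂ _+_ (sumSubsets-∑ n {m} _) (sumSubsets-∑ n {m} _)) (sym (∑-distrib-+ {m} _ _))

sumSubsets-zero : ∀ n {F} → (∀ S → F S ≡ 0) → sumSubsets n F ≡ 0
sumSubsets-zero zero    h = h []
sumSubsets-zero (suc n) h = cong₂ _+_ (sumSubsets-zero n (h ∘ _)) (sumSubsets-zero n (h ∘ _))

length-filterᵇ-allSubsets : ∀ n (p : Subset n → Bool) →
  length (filterᵇ p (allSubsets n)) ≡ sumSubsets n (λ S → ⟦ p S ⟧)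
length-filterᵇ-allSubsets zero p with p []
... | true  = refl
... | false = refl
length-filterᵇ-allSubsets (suc n) p =
  trans (filterᵇ-++ p (map (true ∷_) (allSubsets n)) _)
    (cong₂ _+_ (trans (filterᵇ-map p (true ∷_) (allSubsets n)) (length-filterᵇ-allSubsets n _))
               (trans (filterᵇ-map p (false ∷_) (allSubsets n)) (length-filterᵇ-allSubsets n _)))
  where
  filterᵇ-++ : ∀ {A : Set} (q : A → Bool) xs ys →
    length (filterᵇ q (xs ++ ys)) ≡ length (filterᵇ q xs) + length (filterᵇ q ys)
  filterᵇ-++ q []       ys = refl
  filterᵇ-++ q (x ∷ xs) ys with q x
  ... | true  = cong suc (filterᵇ-++ q xs ys)
  ... | false = filterᵇ-++ q xs ys
  filterᵇ-map : ∀ {A C : Set} (q : C → Bool) (f : A → C) xs →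
    length (filterᵇ q (map f xs)) ≡ length (filterᵇ (q ∘ f) xs)
  filterᵇ-map q f []       = refl
  filterᵇ-map q f (x ∷ xs) with q (f x)
  ... | true  = cong suc (filterᵇ-map q f xs)
  ... | false = filterᵇ-map q f xs

-- Adding `v` is a bijection from the subsets without `v` to those with `v`.
sumSubsets-insert : ∀ {n} v (F : Subset n → ℕ) →
  sumSubsets n (λ S → ⟦ lookup S v ⟧ * F S)
    ≡ sumSubsets n (λ S → ⟦ not (lookup S v) ⟧ * F (S [ v ]≔ true))
sumSubsets-insert {suc n} zero F =
  trans (trans (cong (sumSubsets n (λ S → 1 * F (true ∷ S)) +_) (sumSubsets-zero n λ _ → refl)) (+-comm _ 0))
        (cong (_+ sumSubsets n (λ S → 1 * F (true ∷ S))) (sym (sumSubsets-zero n λ _ → refl)))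
sumSubsets-insert {suc n} (suc v) F =
  cong₂ _+_ (sumSubsets-insert v _) (sumSubsets-insert v _)

sumSubsets-empty : ∀ n → sumSubsets n (λ S → ⟦ ∣ S ∣ ≡ᵇ 0 ⟧) ≡ 1
sumSubsets-empty zero    = refl
sumSubsets-empty (suc n) = cong₂ _+_ (sumSubsets-zero n λ _ → refl) (sumSubsets-empty n)

-- Tuples of `t` pairwise adjacent vertices of `P`, counted by their first vertex: the rest is an
-- ordered clique in its neighbourhood. This is `t !` times the number of `t`-cliques in `P`.
orderedCliques : Graph n → ℕ → BSet n → ℕ
orderedCliques G zero    P = 1
orderedCliques G (suc t) P = sumIn P (λ v → orderedCliques G t (P ∩ adj G v))

module _ (G : Graph n) where

  -- The first conjunct is literally the test that `k` filters by, so for `full` the two counts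
  -- agree.
  isCliqueIn : ℕ → BSet n → Subset n → Bool
  isCliqueIn t P S = ((∣ S ∣ ≡ᵇ t) ∧ isCliqueᵇ G S)
    ∧ allᵇ (λ x → not (lookup S x) ∨ P x) (allFin n)

  record CliqueIn (t : ℕ) (P : BSet n) (S : Subset n) : Set where
    constructor cliqueIn
    field
      size   : ∣ S ∣ ≡ t
      clique : ∀ x y → x ∈ lookup S → y ∈ lookup S → x ≢ y → y ∈ adj G x
      inside : lookup S ⊆ P
  open CliqueIn

  isCliqueIn⇔ : ∀ t P S → isCliqueIn t P S ≡ true ⇔ CliqueIn t P S
  isCliqueIn⇔ t P S = mk⇔ to from
    where
    clique-true : ∀ x y → x ∈ lookup S → y ∈ lookup S → x ≢ y →
      not (lookup S x ∧ lookup S y ∧ not ⌊ x ≟ y ⌋) ∨ adj G x y ≡ true → y ∈ adj G x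
    clique-true x y x∈S y∈S x≢y h rewrite x∈S | y∈S with x ≟ y
    ... | yes x≡y = contradiction x≡y x≢y
    ... | no _    = h
    true-clique : ∀ x y → (x ∈ lookup S → y ∈ lookup S → x ≢ y → y ∈ adj G x) →
      not (lookup S x ∧ lookup S y ∧ not ⌊ x ≟ y ⌋) ∨ adj G x y ≡ true
    true-clique x y h with lookup S x | lookup S y | x ≟ y
    ... | false | _     | _      = refl
    ... | true  | false | _      = refl
    ... | true  | true  | yes _  = refl
    ... | true  | true  | no x≢y = h refl refl x≢y
    true-inside : ∀ x → (x ∈ lookup S → x ∈ P) → not (lookup S x) ∨ P x ≡ true
    true-inside x h with lookup S x
    ... | true  = h refl
    ... | false = refl
    inside-true : ∀ x → x ∈ lookup S → not (lookup S x) ∨ P x ≡ true → x ∈ P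
    inside-true x x∈S h rewrite x∈S = h
    to : isCliqueIn t P S ≡ true → CliqueIn t P S
    to h .size = ≡ᵇ⇒≡ _ _ (Equivalence.from T-≡ (∧-proj₁ (∧-proj₁ h)))
    to h .clique x y x∈S y∈S x≢y = clique-true x y x∈S y∈S x≢y
      (Equivalence.to (allᵇ-allFin _) (Equivalence.to (allᵇ-allFin _) (∧-proj₂ {∣ S ∣ ≡ᵇ t} (∧-proj₁ h)) x) y)
    to h .inside x x∈S = inside-true x x∈S
      (Equivalence.to (allᵇ-allFin _) (∧-proj₂ {(∣ S ∣ ≡ᵇ t) ∧ isCliqueᵇ G S} h) x)
    from : CliqueIn t P S → isCliqueIn t P S ≡ true
    from c = ∧-intro
      (∧-intro (Equivalence.to T-≡ (≡⇒≡ᵇ _ _ (c .size)))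
        (Equivalence.from (allᵇ-allFin _) λ x → Equivalence.from (allᵇ-allFin _) λ y →
           true-clique x y (c .clique x y)))
      (Equivalence.from (allᵇ-allFin _) λ x → true-inside x (c .inside x))

  cliquesIn : ℕ → BSet n → ℕ
  cliquesIn t P = sumSubsets n (λ S → ⟦ isCliqueIn t P S ⟧)

  k≡cliquesIn : ∀ t → k t G ≡ cliquesIn t full
  k≡cliquesIn t = trans (length-filterᵇ-allSubsets n _) (sumSubsets-cong n λ S → cong ⟦_⟧ (sym (drop S)))
    where
    drop : ∀ S → isCliqueIn t full S ≡ (∣ S ∣ ≡ᵇ t) ∧ isCliqueᵇ G S
    drop S = trans (cong (((∣ S ∣ ≡ᵇ t) ∧ isCliqueᵇ G S) ∧_)
                     (Equivalence.from (allᵇ-allFin _) λ x → ∨-zeroʳ (not (lookup S x))))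
                   (∧-identityʳ _)

  module _ (S : Subset n) (v : Fin n) where

    private
      S⁺ : Subset n
      S⁺ = S [ v ]≔ true

      old : ∀ {x} → v ≢ x → lookup S⁺ x ≡ lookup S x
      old v≢x = lookup∘update′ (v≢x ∘ sym) S true

    ∣insert∣ : v ∉ lookup S → ∣ S⁺ ∣ ≡ suc ∣ S ∣
    ∣insert∣ = go S v
      where
      go : ∀ {m} (S : Subset m) v → v ∉ lookup S → ∣ S [ v ]≔ true ∣ ≡ suc ∣ S ∣
      go (false ∷ S) zero    _ = refl
      go (true ∷ S)  (suc v) e = cong suc (go S v e)
      go (false ∷ S) (suc v) e = go S v e

    insert-clique : ∀ t P → v ∉ lookup S →
      CliqueIn (suc t) P S⁺ ⇔ (v ∈ P × CliqueIn t (P ∩ adj G v) S)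
    insert-clique t P v∉S = mk⇔ to from
      where
      ≢v : ∀ {x} → x ∈ lookup S → v ≢ x
      ≢v x∈S refl = true≢false x∈S v∉S
      up : ∀ {x} → x ∈ lookup S → x ∈ lookup S⁺
      up x∈S = trans (old (≢v x∈S)) x∈S
      v∈ : v ∈ lookup S⁺
      v∈ = lookup∘update v S true
      to : CliqueIn (suc t) P S⁺ → v ∈ P × CliqueIn t (P ∩ adj G v) S
      to c = c .inside v v∈ , cliqueIn
        (suc-injective (trans (sym (∣insert∣ v∉S)) (c .size)))
        (λ x y x∈S y∈S → c .clique x y (up x∈S) (up y∈S))
        (λ x x∈S → ∧-intro (c .inside x (up x∈S)) (c .clique v x v∈ (up x∈S) (≢v x∈S)))
      from : v ∈ P × CliqueIn t (P ∩ adj G v) S → CliqueIn (suc t) P S⁺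
      from (v∈P , c) = cliqueIn (trans (∣insert∣ v∉S) (cong suc (c .size))) cl ins
        where
        ins : lookup S⁺ ⊆ P
        ins x x∈ with v ≟ x
        ... | yes refl = v∈P
        ... | no v≢x   = ∧-proj₁ (c .inside x (trans (sym (old v≢x)) x∈))
        cl : ∀ x y → x ∈ lookup S⁺ → y ∈ lookup S⁺ → x ≢ y → y ∈ adj G x
        cl x y x∈ y∈ x≢y with v ≟ x | v ≟ y
        ... | yes refl | yes refl = contradiction refl x≢y
        ... | yes refl | no v≢y   = ∧-proj₂ {P y} (c .inside y (trans (sym (old v≢y)) y∈))
        ... | no v≢x   | yes refl =
          trans (adj-sym G x y) (∧-proj₂ {P x} (c .inside x (trans (sym (old v≢x)) x∈)))
        ... | no v≢x   | no v≢y   = c .clique x y (trans (sym (old v≢x)) x∈) (trans (sym (old v≢y)) y∈) x≢y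

    -- If `v` is already in `S`, both sides vanish: the left by its first factor, the right because
    -- `v` is not its own neighbour. Otherwise this is `insert-clique` in Boolean form.
    insert-isCliqueIn : ∀ t P → ⟦ not (lookup S v) ⟧ * ⟦ isCliqueIn (suc t) P S⁺ ⟧
      ≡ ⟦ P v ⟧ * ⟦ isCliqueIn t (P ∩ adj G v) S ⟧
    insert-isCliqueIn t P with lookup S v in e
    ... | true = sym (trans (cong (⟦ P v ⟧ *_) (cong ⟦_⟧ absurd)) (*-zeroʳ ⟦ P v ⟧))
      where
      absurd : isCliqueIn t (P ∩ adj G v) S ≡ false
      absurd = ¬-not λ h → true≢false
        (∧-proj₂ {P v} (Equivalence.to (isCliqueIn⇔ t (P ∩ adj G v) S) h .inside v e)) (irref G v)
    ... | false = trans (*-identityˡ _) (trans (cong ⟦_⟧ eq) (⟦∧⟧ (P v)))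
      where
      ⟦∧⟧ : ∀ a {b} → ⟦ a ∧ b ⟧ ≡ ⟦ a ⟧ * ⟦ b ⟧
      ⟦∧⟧ true  = sym (*-identityˡ _)
      ⟦∧⟧ false = refl
      to⁺ = Equivalence.to (isCliqueIn⇔ (suc t) P S⁺)
      from⁺ = Equivalence.from (isCliqueIn⇔ (suc t) P S⁺)
      to⁻ = Equivalence.to (isCliqueIn⇔ t (P ∩ adj G v) S)
      from⁻ = Equivalence.from (isCliqueIn⇔ t (P ∩ adj G v) S)
      eq : isCliqueIn (suc t) P S⁺ ≡ P v ∧ isCliqueIn t (P ∩ adj G v) S
      eq = ⇔→≡ {z = true} (mk⇔
        (λ h → let (p , c) = Equivalence.to (insert-clique t P e) (to⁺ h) in ∧-intro p (from⁻ c))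
        (λ h → from⁺ (Equivalence.from (insert-clique t P e) (∧-proj₁ h , to⁻ (∧-proj₂ {P v} h)))))

  -- Double counting of the pairs of a clique and one of its vertices `v`: deleting `v` leaves a
  -- clique inside the neighbourhood of `v`.
  cliquesIn-suc : ∀ t P → suc t * cliquesIn (suc t) P ≡ sumIn P (λ v → cliquesIn t (P ∩ adj G v))
  cliquesIn-suc t P = begin
    suc t * cliquesIn (suc t) P
      ≡⟨ sumSubsets-* n (suc t) _ ⟨
    sumSubsets n (λ S → suc t * ⟦ isCliqueIn (suc t) P S ⟧)
      ≡⟨ sumSubsets-cong n by-size ⟩
    sumSubsets n (λ S → sum (λ v → ⟦ lookup S v ⟧ * ⟦ isCliqueIn (suc t) P S ⟧))
      ≡⟨ sumSubsets-∑ n {n} _ ⟩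
    sum (λ v → sumSubsets n (λ S → ⟦ lookup S v ⟧ * ⟦ isCliqueIn (suc t) P S ⟧))
      ≡⟨ sum-cong-≗ {n} (λ v → sumSubsets-insert {n} v _) ⟩
    sum (λ v → sumSubsets n (λ S → ⟦ not (lookup S v) ⟧ * ⟦ isCliqueIn (suc t) P (S [ v ]≔ true) ⟧))
      ≡⟨ sum-cong-≗ (λ v → sumSubsets-cong n λ S → insert-isCliqueIn S v t P) ⟩
    sum (λ v → sumSubsets n (λ S → ⟦ P v ⟧ * ⟦ isCliqueIn t (P ∩ adj G v) S ⟧))
      ≡⟨ sum-cong-≗ (λ v → sumSubsets-* n ⟦ P v ⟧ _) ⟩
    sumIn P (λ v → cliquesIn t (P ∩ adj G v)) ∎
    where
    open ≡-Reasoning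
    by-size : ∀ S → suc t * ⟦ isCliqueIn (suc t) P S ⟧
      ≡ sum (λ v → ⟦ lookup S v ⟧ * ⟦ isCliqueIn (suc t) P S ⟧)
    by-size S with isCliqueIn (suc t) P S in e
    ... | true  = trans (cong (_* 1) (trans (sym (size (Equivalence.to (isCliqueIn⇔ (suc t) P S) e))) (∣∣≡#lookup S)))
                        (*-distribʳ-sum 1 (λ v → ⟦ lookup S v ⟧))
    ... | false = trans (*-zeroʳ (suc t)) (sym (sum-zero λ v → *-zeroʳ ⟦ lookup S v ⟧))

  cliquesIn-zero : ∀ P → cliquesIn 0 P ≡ 1
  cliquesIn-zero P = trans (sumSubsets-cong n λ S → cong ⟦_⟧ (eq S)) (sumSubsets-empty n)
    where
    eq : ∀ S → isCliqueIn 0 P S ≡ (∣ S ∣ ≡ᵇ 0)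
    eq S = ⇔→≡ {z = true} (mk⇔ (λ h → ∧-proj₁ (∧-proj₁ h)) λ h →
      let ∣S∣≡0 = ≡ᵇ⇒≡ ∣ S ∣ 0 (Equivalence.from T-≡ h)
          absurd : ∀ {A : Set} x → x ∈ lookup S → A
          absurd x x∈S = contradiction
            (≤-trans (#-add (λ _ → false) (lookup S) x (λ _ ()) x∈S refl)
                     (≤-reflexive (trans (sym (∣∣≡#lookup S)) ∣S∣≡0))) λ ()
      in Equivalence.from (isCliqueIn⇔ 0 P S)
           (cliqueIn ∣S∣≡0 (λ x _ x∈S → absurd x x∈S) (λ x x∈S → absurd x x∈S)))

  !*cliquesIn≡orderedCliques : ∀ t P → t ! * cliquesIn t P ≡ orderedCliques G t P
  !*cliquesIn≡orderedCliques zero P = trans (*-identityˡ _) (cliquesIn-zero P)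
  !*cliquesIn≡orderedCliques (suc t) P = begin
    suc t * t ! * cliquesIn (suc t) P                        ≡⟨ rearrange (suc t) (t !) _ ⟩
    t ! * (suc t * cliquesIn (suc t) P)                      ≡⟨ cong (t ! *_) (cliquesIn-suc t P) ⟩
    t ! * sumIn P (λ v → cliquesIn t (P ∩ adj G v))          ≡⟨ sumIn-* P (t !) _ ⟨
    sumIn P (λ v → t ! * cliquesIn t (P ∩ adj G v))
      ≡⟨ sum-cong-≗ (λ v → cong (⟦ P v ⟧ *_) (!*cliquesIn≡orderedCliques t (P ∩ adj G v))) ⟩
    sumIn P (λ v → orderedCliques G t (P ∩ adj G v))         ∎
    where
    open ≡-Reasoning
    rearrange : ∀ a b c → a * b * c ≡ b * (a * c)
    rearrange = solve-∀

  !*k≡orderedCliques : ∀ t → t ! * k t G ≡ orderedCliques G t full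
  !*k≡orderedCliques t = trans (cong (t ! *_) (k≡cliquesIn t)) (!*cliquesIn≡orderedCliques t full)

-- Falling factorials

infixr 8 _↓_

_↓_ : ℕ → ℕ → ℕ
m ↓ zero  = 1
m ↓ suc s = m * (m ∸ 1) ↓ s

↓-suc : ∀ m s → m ↓ suc s ≡ m ↓ s * (m ∸ s)
↓-suc m zero    = trans (*-identityʳ m) (sym (+-identityʳ m))
↓-suc m (suc s) = begin
  m * (m ∸ 1) ↓ suc s               ≡⟨ cong (m *_) (↓-suc (m ∸ 1) s) ⟩
  m * ((m ∸ 1) ↓ s * (m ∸ 1 ∸ s))   ≡⟨ *-assoc m _ _ ⟨
  m * (m ∸ 1) ↓ s * (m ∸ 1 ∸ s)     ≡⟨ cong (m * (m ∸ 1) ↓ s *_) (∸-+-assoc m 1 s) ⟩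
  m * (m ∸ 1) ↓ s * (m ∸ suc s)     ∎
  where open ≡-Reasoning

↓-monoˡ-≤ : ∀ s {m p} → m ≤ p → m ↓ s ≤ p ↓ s
↓-monoˡ-≤ zero    m≤p = ≤-refl
↓-monoˡ-≤ (suc s) m≤p = *-mono-≤ m≤p (↓-monoˡ-≤ s (∸-monoˡ-≤ 1 m≤p))

-- The number of ordered s-cliques of K_{m+2} minus an edge: the first vertex is one of the two
-- non-adjacent ones, which leaves K_m, or it is one of the m others.
nearClique : ℕ → ℕ → ℕ
nearClique zero    m = 1
nearClique (suc s) m = 2 * m ↓ s + m * nearClique s (m ∸ 1)

-- With r = `suc m` and b = r - s, this is the recurrence for h⁻: each ordered `s`-clique has b
-- common neighbours, and the `m ↓ s` that avoid both non-adjacent vertices have one more. The proof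
-- is an induction on the recursion by first vertex.
nearClique-suc : ∀ s b m → s + b ≡ suc m → nearClique (suc s) m ≡ b * nearClique s m + m ↓ s
nearClique-suc zero    b m       refl = base m
  where
  base : ∀ m → 2 * 1 + m * 1 ≡ (1 + m) * 1 + 1
  base = solve-∀
nearClique-suc (suc zero) zero zero refl = refl
nearClique-suc (suc zero) (suc b) zero ()
nearClique-suc (suc (suc s)) b zero ()
nearClique-suc (suc s) b (suc m) eq = begin
  2 * (M * F) + M * nearClique (suc s) m     ≡⟨ cong (λ z → 2 * (M * F) + M * z) (nearClique-suc s b m s+b≡) ⟩
  2 * (M * F) + M * (b * C + F)              ≡⟨ cong (λ z → 2 * z + M * (b * C + F)) MF≡bF⁺ ⟩
  2 * (b * F⁺) + M * (b * C + F)             ≡⟨ algebra M F F⁺ C b ⟩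
  b * (2 * F⁺ + M * C) + M * F               ∎
  where
  open ≡-Reasoning
  M F F⁺ C : ℕ
  M  = suc m
  F  = m ↓ s
  F⁺ = M ↓ s
  C  = nearClique s m
  s+b≡ : s + b ≡ suc m
  s+b≡ = suc-injective eq
  -- Both sides are `M ↓ suc s`, with the first or the last factor split off.
  MF≡bF⁺ : M * F ≡ b * F⁺
  MF≡bF⁺ = trans (↓-suc M s) (trans (*-comm F⁺ _)
    (cong (_* F⁺) (trans (cong (_∸ s) (sym s+b≡)) (m+n∸m≡n s b))))
  algebra : ∀ M F F⁺ C b → 2 * (b * F⁺) + M * (b * C + F) ≡ b * (2 * F⁺ + M * C) + M * F
  algebra = solve-∀

-- Bounds for the extension of ordered cliques

module _ (G : Graph n) where

  #-∩adj : ∀ P {v} → v ∈ P → suc (# (P ∩ adj G v)) ≤ # P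
  #-∩adj P {v} v∈P = #-add (P ∩ adj G v) P v (λ _ → ∧-proj₁) v∈P
    (trans (cong (P v ∧_) (irref G v)) (∧-zeroʳ (P v)))

  -- A further vertex must differ from the `s` chosen ones, which leaves at most `b` candidates. In
  -- the induction, passing to a neighbourhood removes at least the chosen vertex from `P`.
  orderedCliques-suc-≤ : ∀ s b P → # P ≤ b + s → orderedCliques G (suc s) P ≤ b * orderedCliques G s P
  orderedCliques-suc-≤ zero b P #P≤ = begin
    sumIn P (λ _ → 1)  ≡⟨ #-sumIn P ⟩
    # P                ≤⟨ #P≤ ⟩
    b + 0              ≡⟨ trans (+-identityʳ b) (sym (*-identityʳ b)) ⟩
    b * 1              ∎
    where open ≤-Reasoning
  orderedCliques-suc-≤ (suc s) b P #P≤ = begin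
    sumIn P (λ v → orderedCliques G (suc s) (P ∩ adj G v))
      ≤⟨ sumIn-mono P (λ v v∈P → orderedCliques-suc-≤ s b (P ∩ adj G v)
           (≤-pred (≤-trans (#-∩adj P v∈P) (≤-trans #P≤ (≤-reflexive (+-suc b s)))))) ⟩
    sumIn P (λ v → b * orderedCliques G s (P ∩ adj G v))
      ≡⟨ sumIn-* P b _ ⟩
    b * sumIn P (λ v → orderedCliques G s (P ∩ adj G v))
      ∎
    where open ≤-Reasoning

  -- An ordered s-clique in P extends in at most b ways, except that one consisting of
  -- vertices of U, which are adjacent to all of P, may extend in b + 1 ways.
  orderedCliques-suc-≤-universal : ∀ s b P U → # P ≤ suc (b + s) →
    (∀ u x → u ∈ U → x ∈ P → u ≢ x → x ∈ adj G u) →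
    (∀ u → u ∈ P → u ∉ U → ∃ λ x → x ∈ P × u ≢ x × x ∉ adj G u) →
    orderedCliques G (suc s) P ≤ b * orderedCliques G s P + # (P ∩ U) ↓ s
  orderedCliques-suc-≤-universal zero b P U #P≤ _ _ = begin
    sumIn P (λ _ → 1)  ≡⟨ #-sumIn P ⟩
    # P                ≤⟨ #P≤ ⟩
    suc (b + 0)        ≡⟨ eq b ⟩
    b * 1 + 1          ∎
    where
    open ≤-Reasoning
    eq : ∀ b → 1 + (b + 0) ≡ b * 1 + 1
    eq = solve-∀
  orderedCliques-suc-≤-universal (suc s) b P U #P≤ universal missing = begin
    sumIn P (λ v → orderedCliques G (suc s) (P ∩ adj G v))
      ≤⟨ sumIn-mono P pointwise ⟩
    sumIn P (λ v → b * orderedCliques G s (P ∩ adj G v) + ⟦ U v ⟧ * (# (P ∩ U) ∸ 1) ↓ s)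
      ≡⟨ sumIn-+ P _ _ ⟩
    sumIn P (λ v → b * orderedCliques G s (P ∩ adj G v)) + sumIn P (λ v → ⟦ U v ⟧ * (# (P ∩ U) ∸ 1) ↓ s)
      ≡⟨ cong₂ _+_ (sumIn-* P b _) (sumIn-⟦⟧ P U _) ⟩
    b * orderedCliques G (suc s) P + # (P ∩ U) ↓ suc s
      ∎
    where
    open ≤-Reasoning
    pointwise : ∀ v → v ∈ P → orderedCliques G (suc s) (P ∩ adj G v)
      ≤ b * orderedCliques G s (P ∩ adj G v) + ⟦ U v ⟧ * (# (P ∩ U) ∸ 1) ↓ s
    pointwise v v∈P with U v in e
    ... | false = ≤-trans (orderedCliques-suc-≤ s b (P ∩ adj G v) smaller) (m≤m+n _ _)
      where
      -- A vertex outside `U` loses itself and a non-neighbour, so the set shrinks by two and the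
      -- plain bound applies with the same `b`.
      smaller : # (P ∩ adj G v) ≤ b + s
      smaller with missing v v∈P e
      ... | x , x∈P , v≢x , x∉Nv = ≤-pred (≤-pred (begin
        2 + # (P ∩ adj G v)  ≤⟨ #-add₂ (P ∩ adj G v) P v x (λ _ → ∧-proj₁) v∈P x∈P
                                  (trans (cong (P v ∧_) (irref G v)) (∧-zeroʳ (P v)))
                                  (trans (cong (P x ∧_) x∉Nv) (∧-zeroʳ (P x))) v≢x ⟩
        # P                  ≤⟨ #P≤ ⟩
        suc (b + suc s)      ≡⟨ cong suc (+-suc b s) ⟩
        2 + (b + s)          ∎))
    ... | true = begin
      orderedCliques G (suc s) (P ∩ adj G v)
        ≤⟨ orderedCliques-suc-≤-universal s b (P ∩ adj G v) U
             (≤-pred (≤-trans (#-∩adj P v∈P) (≤-trans #P≤ (≤-reflexive (cong suc (+-suc b s))))))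
             (λ u x u∈U x∈ → universal u x u∈U (∧-proj₁ x∈)) missing-v ⟩
      b * orderedCliques G s (P ∩ adj G v) + # ((P ∩ adj G v) ∩ U) ↓ s
        ≤⟨ +-monoʳ-≤ _ (↓-monoˡ-≤ s (∸-monoˡ-≤ 1 fewer)) ⟩
      b * orderedCliques G s (P ∩ adj G v) + (# (P ∩ U) ∸ 1) ↓ s
        ≡⟨ cong (b * orderedCliques G s (P ∩ adj G v) +_) (*-identityˡ _) ⟨
      b * orderedCliques G s (P ∩ adj G v) + 1 * (# (P ∩ U) ∸ 1) ↓ s
        ∎
      where
      -- The non-neighbour of `u` survives in the neighbourhood of `v`, since `v` is adjacent to all
      -- the rest of `P`; it is not `v`, because `u` is adjacent to `v`.
      missing-v : ∀ u → u ∈ P ∩ adj G v → u ∉ U → ∃ λ x → x ∈ P ∩ adj G v × u ≢ x × x ∉ adj G u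
      missing-v u u∈ u∉U with missing u (∧-proj₁ u∈) u∉U
      ... | x , x∈P , u≢x , x∉Nu = x , ∧-intro x∈P (universal v x e x∈P v≢x) , u≢x , x∉Nu
        where
        v≢x : v ≢ x
        v≢x refl = true≢false (trans (adj-sym G u v) (∧-proj₂ {P u} u∈)) x∉Nu
      fewer : suc (# ((P ∩ adj G v) ∩ U)) ≤ # (P ∩ U)
      fewer = #-add ((P ∩ adj G v) ∩ U) (P ∩ U) v
        (λ x x∈ → ∧-intro (∧-proj₁ (∧-proj₁ x∈)) (∧-proj₂ {(P ∩ adj G v) x} x∈))
        (∧-intro v∈P e)
        (cong (_∧ U v) (trans (cong (P v ∧_) (irref G v)) (∧-zeroʳ (P v))))

  clique⇒↓≤orderedCliques : ∀ s m P → m ≤ # P → (∀ x y → x ∈ P → y ∈ P → x ≢ y → y ∈ adj G x) →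
    m ↓ s ≤ orderedCliques G s P
  clique⇒↓≤orderedCliques zero    m P m≤ clique = ≤-refl
  clique⇒↓≤orderedCliques (suc s) m P m≤ clique = begin
    m * (m ∸ 1) ↓ s                                    ≤⟨ *-monoˡ-≤ _ m≤ ⟩
    # P * (m ∸ 1) ↓ s                                  ≡⟨ sumIn-const P _ ⟨
    sumIn P (λ _ → (m ∸ 1) ↓ s)
      ≤⟨ sumIn-mono P (λ v v∈P → clique⇒↓≤orderedCliques s (m ∸ 1) (P ∩ adj G v)
           (∸-monoˡ-≤ 1 (≤-trans m≤ (#-∖only v v∈P)))
           (λ x y x∈ y∈ → clique x y (∧-proj₁ x∈) (∧-proj₁ y∈))) ⟩
    sumIn P (λ v → orderedCliques G s (P ∩ adj G v))   ∎
    where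
    open ≤-Reasoning
    #-∖only : ∀ v → v ∈ P → # P ≤ suc (# (P ∩ adj G v))
    #-∖only v v∈P = ≤-trans (#-remove P v) (s≤s (#-⊆ (P ∖ only v) (P ∩ adj G v) λ x x∈ →
      ∧-intro (∧-proj₁ x∈) (clique v x v∈P (∧-proj₁ x∈) (∉-only⇒≢ (not-elim (∧-proj₂ {P x} x∈))))))

  module _ (a b : Fin n) (a≢b : a ≢ b)
    (others : ∀ x y → x ≢ y → ¬ (x ≡ a × y ≡ b) → ¬ (x ≡ b × y ≡ a) → y ∈ adj G x) where

    -- Follows the recursion of `nearClique`: after `a` or `b` what remains is a clique on at least
    -- `m` vertices, and after any other vertex both `a` and `b` remain.
    nearClique≤orderedCliques : ∀ s m P → a ∈ P → b ∈ P → 2 + m ≤ # P → nearClique s m ≤ orderedCliques G s P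
    nearClique≤orderedCliques zero    m P a∈P b∈P 2+m≤ = ≤-refl
    nearClique≤orderedCliques (suc s) m P a∈P b∈P 2+m≤ = begin
      2 * m ↓ s + m * nearClique s (m ∸ 1)
        ≡⟨ split (m ↓ s) (m * nearClique s (m ∸ 1)) ⟩
      1 * m ↓ s + 1 * m ↓ s + m * nearClique s (m ∸ 1)
        ≤⟨ +-mono-≤ (+-mono-≤ (*-monoˡ-≤ _ (∈⇒1≤# (P ∩ only a) (∧-intro a∈P (∈-only a))))
                              (*-monoˡ-≤ _ (∈⇒1≤# (P ∩ only b) (∧-intro b∈P (∈-only b)))))
                    (*-monoˡ-≤ _ (≤-trans m≤#Q (#-⊆ Q (P ∩ Q) λ x x∈Q → ∧-intro (proj₁ (Q-spec x∈Q)) x∈Q))) ⟩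
      # (P ∩ only a) * m ↓ s + # (P ∩ only b) * m ↓ s + # (P ∩ Q) * nearClique s (m ∸ 1)
        ≡⟨ cong₂ _+_ (cong₂ _+_ (sumIn-⟦⟧ P (only a) _) (sumIn-⟦⟧ P (only b) _)) (sumIn-⟦⟧ P Q _) ⟨
      sumIn P (λ v → ⟦ only a v ⟧ * m ↓ s) + sumIn P (λ v → ⟦ only b v ⟧ * m ↓ s)
        + sumIn P (λ v → ⟦ Q v ⟧ * nearClique s (m ∸ 1))
        ≡⟨ trans (sumIn-+ P _ _) (cong (_+ sumIn P (λ v → ⟦ Q v ⟧ * nearClique s (m ∸ 1))) (sumIn-+ P _ _)) ⟨
      sumIn P (λ v → ⟦ only a v ⟧ * m ↓ s + ⟦ only b v ⟧ * m ↓ s + ⟦ Q v ⟧ * nearClique s (m ∸ 1))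
        ≤⟨ sumIn-mono P pointwise ⟩
      sumIn P (λ v → orderedCliques G s (P ∩ adj G v))
        ∎
      where
      open ≤-Reasoning
      Q : BSet n
      Q = (P ∖ only a) ∖ only b
      split : ∀ x y → 2 * x + y ≡ 1 * x + 1 * x + y
      split = solve-∀
      m≤#Q : m ≤ # Q
      m≤#Q = ≤-pred (≤-pred (≤-trans 2+m≤ (≤-trans (#-remove P a) (s≤s (#-remove (P ∖ only a) b)))))
      Q-spec : ∀ {x} → x ∈ Q → x ∈ P × a ≢ x × b ≢ x
      Q-spec {x} x∈Q = ∧-proj₁ (∧-proj₁ x∈Q)
        , ∉-only⇒≢ (not-elim (∧-proj₂ {P x} (∧-proj₁ x∈Q)))
        , ∉-only⇒≢ (not-elim (∧-proj₂ {(P ∖ only a) x} x∈Q))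
      exclusive : ∀ c → (∀ x → x ∈ Q → x ∈ adj G c) →
        (∀ x y → x ∈ adj G c → y ∈ adj G c → x ≢ y → y ∈ adj G x) →
        m ↓ s ≤ orderedCliques G s (P ∩ adj G c)
      exclusive c Q⊆Nc clique = clique⇒↓≤orderedCliques s m (P ∩ adj G c)
        (≤-trans m≤#Q (#-⊆ Q (P ∩ adj G c) λ x x∈Q → ∧-intro (proj₁ (Q-spec x∈Q)) (Q⊆Nc x x∈Q)))
        (λ x y x∈ y∈ → clique x y (∧-proj₂ {P x} x∈) (∧-proj₂ {P y} y∈))
      ∉self : ∀ {c} → c ∈ adj G c → ∀ {A : Set} → A
      ∉self c∈ = true≢false c∈ (irref G _)
      at-a : m ↓ s ≤ orderedCliques G s (P ∩ adj G a)
      at-a = exclusive a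
        (λ x x∈Q → let (_ , a≢x , b≢x) = Q-spec x∈Q in
           others a x a≢x (λ (_ , e) → b≢x (sym e)) (λ (e , _) → a≢b e))
        (λ x y x∈ y∈ x≢y → others x y x≢y (λ { (refl , _) → ∉self x∈ }) (λ { (_ , refl) → ∉self y∈ }))
      at-b : m ↓ s ≤ orderedCliques G s (P ∩ adj G b)
      at-b = exclusive b
        (λ x x∈Q → let (_ , a≢x , b≢x) = Q-spec x∈Q in
           others b x b≢x (λ (e , _) → a≢b (sym e)) (λ (_ , e) → a≢x (sym e)))
        (λ x y x∈ y∈ x≢y → others x y x≢y (λ { (_ , refl) → ∉self y∈ }) (λ { (refl , _) → ∉self x∈ }))
      at-Q : ∀ v → v ∈ Q → nearClique s (m ∸ 1) ≤ orderedCliques G s (P ∩ adj G v)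
      at-Q v v∈Q = nearClique≤orderedCliques s (m ∸ 1) (P ∩ adj G v) a∈ b∈ (size m 2+m≤)
        where
        universal : ∀ x → v ≢ x → x ∈ adj G v
        universal x v≢x = let (_ , a≢v , b≢v) = Q-spec v∈Q in
          others v x v≢x (λ (e , _) → a≢v (sym e)) (λ (e , _) → b≢v (sym e))
        a∈ : a ∈ P ∩ adj G v
        a∈ = ∧-intro a∈P (universal a λ { refl → proj₁ (proj₂ (Q-spec v∈Q)) refl })
        b∈ : b ∈ P ∩ adj G v
        b∈ = ∧-intro b∈P (universal b λ { refl → proj₂ (proj₂ (Q-spec v∈Q)) refl })
        size : ∀ m → 2 + m ≤ # P → 2 + (m ∸ 1) ≤ # (P ∩ adj G v)
        -- Here `m ∸ 1` is again 0, and `a` and `b` alone supply the two elements.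
        size zero    _    = ≤-trans (+-monoʳ-≤ 2 z≤n)
          (#-add₂ (λ _ → false) (P ∩ adj G v) a b (λ _ ()) a∈ b∈ refl refl a≢b)
        size (suc m) 3+m≤ = ≤-pred (≤-trans 3+m≤ (≤-trans (#-remove P v)
          (s≤s (#-⊆ (P ∖ only v) (P ∩ adj G v) λ x x∈ →
            ∧-intro (∧-proj₁ x∈) (universal x (∉-only⇒≢ (not-elim (∧-proj₂ {P x} x∈))))))))
      pointwise : ∀ v → v ∈ P → ⟦ only a v ⟧ * m ↓ s + ⟦ only b v ⟧ * m ↓ s + ⟦ Q v ⟧ * nearClique s (m ∸ 1)
        ≤ orderedCliques G s (P ∩ adj G v)
      pointwise v v∈P with Q v in e
      ... | true rewrite ∉-only (proj₁ (proj₂ (Q-spec e))) | ∉-only (proj₂ (proj₂ (Q-spec e))) =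
        ≤-trans (≤-reflexive (*-identityˡ _)) (at-Q v e)
      ... | false with a ≟ v | b ≟ v
      ...   | yes refl | yes b≡a  = contradiction (sym b≡a) a≢b
      ...   | yes refl | no _     = ≤-trans (≤-reflexive (drop (m ↓ s))) at-a
        where
        drop : ∀ x → 1 * x + 0 + 0 ≡ x
        drop = solve-∀
      ...   | no _     | yes refl = ≤-trans (≤-reflexive (drop (m ↓ s))) at-b
        where
        drop : ∀ x → 0 + 1 * x + 0 ≡ x
        drop = solve-∀
      ...   | no _     | no _     = z≤n

-- Discharging

-- Averaging scheme for triangles and for twin classes: a vertex whose value may exceed the target
-- `τ` is averaged over its whole set `B v`, and such sets do not overlap partially.
module _ (B : Fin n → BSet n) (rich : BSet n) (g : Fin n → ℕ) (τ : ℕ)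
  (centre : ∀ v → v ∈ B v)
  (poor-≤ : ∀ v → v ∉ rich → g v ≤ τ)
  (rich-≤ : ∀ v → v ∈ rich → sumIn (B v) g ≤ # (B v) * τ)
  (rich-disjoint : ∀ v w → v ∈ rich → w ∈ rich → w ∉ B v → Disjoint (B v) (B w))
  where

  private
    Closed : BSet n → Set
    Closed S = ∀ v → v ∈ rich → v ∈ S → B v ⊆ S

    -- Induction on a bound `m` for the size of `S`. If `S` contains a rich `v`, its whole `B v` is
    -- split off. What is left is still closed, because a rich `w` outside `B v` has `B w` disjoint
    -- from `B v`.
    closed-≤ : ∀ m S → # S ≤ m → Closed S → sumIn S g ≤ # S * τ
    closed-≤ m S #S≤ closed with any? (λ v → (S ∩ rich) v Bool.≟ true)
    ... | no none = ≤-trans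
      (sumIn-mono S λ v v∈S → poor-≤ v (¬-not λ v∈rich → none (v , ∧-intro v∈S v∈rich)))
      (≤-reflexive (sumIn-const S τ))
    closed-≤ zero S #S≤ closed | yes (v , v∈) =
      contradiction (≤-trans (∈⇒1≤# S {v} (∧-proj₁ v∈)) #S≤) λ ()
    closed-≤ (suc m) S #S≤ closed | yes (v , v∈) = begin
      sumIn S g                                    ≡⟨ sumIn-split S (B v) g ⟩
      sumIn (S ∩ B v) g + sumIn (S ∖ B v) g        ≤⟨ +-mono-≤ (sumIn-⊆ (S ∩ B v) (B v) λ x → ∧-proj₂ {S x})
                                                       (closed-≤ m (S ∖ B v) smaller still-closed) ⟩
      sumIn (B v) g + # (S ∖ B v) * τ              ≤⟨ +-monoˡ-≤ _ (rich-≤ v v∈rich) ⟩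
      # (B v) * τ + # (S ∖ B v) * τ                ≡⟨ *-distribʳ-+ τ (# (B v)) _ ⟨
      (# (B v) + # (S ∖ B v)) * τ                  ≤⟨ *-monoˡ-≤ τ (+-monoˡ-≤ _ (#-⊆ (B v) (S ∩ B v)
                                                        λ x x∈B → ∧-intro (B⊆S x x∈B) x∈B)) ⟩
      (# (S ∩ B v) + # (S ∖ B v)) * τ              ≡⟨ cong (_* τ) (#-split S (B v)) ⟨
      # S * τ                                      ∎
      where
      open ≤-Reasoning
      v∈S : v ∈ S
      v∈S = ∧-proj₁ v∈
      v∈rich : v ∈ rich
      v∈rich = ∧-proj₂ {S v} v∈
      B⊆S : B v ⊆ S
      B⊆S = closed v v∈rich v∈S
      smaller : # (S ∖ B v) ≤ m
      smaller = ≤-pred (≤-trans (#-add (S ∖ B v) S v (λ _ → ∧-proj₁) v∈S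
        (trans (cong (λ b → S v ∧ not b) (centre v)) (∧-zeroʳ (S v)))) #S≤)
      still-closed : Closed (S ∖ B v)
      still-closed w w∈rich w∈ x x∈Bw = ∧-intro (closed w w∈rich (∧-proj₁ w∈) x x∈Bw)
        (not-intro (¬-not λ x∈Bv → true≢false x∈Bw
          (rich-disjoint v w v∈rich w∈rich (not-elim (∧-proj₂ {S w} w∈)) x x∈Bv)))

  discharge : sum g ≤ n * τ
  discharge = begin
    sum g            ≡⟨ sumIn-full g ⟨
    sumIn full g     ≤⟨ closed-≤ (# (full {n})) full ≤-refl (λ _ _ _ _ _ → refl) ⟩
    # (full {n}) * τ ≡⟨ cong (_* τ) (#-full n) ⟩
    n * τ            ∎
    where open ≤-Reasoning

-- Local structure

-- The parameter `ρ` is r - 2, so that r - 1 and r - 2 are written without truncated subtraction.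
module Local (G : Graph n) (ρ : ℕ)
  (Δ≤ : ∀ v → # (adj G v) ≤ 2 + ρ)
  (ω≤ : CliqueNumber≤ G (2 + ρ))
  where

  -- B v is the closed neighbourhood of v. If v has degree r = 2 + ρ, then C v is the set of the
  -- vertices whose closed neighbourhood is B v.
  N B C E : Fin n → BSet n
  common excess : Fin n → ℕ
  inner deficit : Fin n → Fin n → ℕ

  N = adj G
  B v x = only v x ∨ N v x

  inner v a = # (N a ∩ B v)
  deficit v a = 2 + ρ ∸ inner v a

  C v x = B v x ∧ ⌊ 2 + ρ ≤? inner v x ⌋
  E v = B v ∖ C v

  -- With `deficit v a` as s_a, `excess` is σ. The value `common v` is the number of ordered edges
  -- inside `N v`, hence of ordered triangles that start at `v`.
  excess v = sumIn (B v) (deficit v)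
  common v = sumIn (N v) (λ u → # (N v ∩ N u))

  Saturated : Fin n → Set
  Saturated v = # (N v) ≡ 2 + ρ

  ∉N-self : ∀ v → v ∉ N v
  ∉N-self = irref G

  N-sym : ∀ {u v} → v ∈ N u → u ∈ N v
  N-sym {u} {v} = trans (adj-sym G v u)

  B-centre : ∀ v → v ∈ B v
  B-centre v = cong (_∨ N v v) (∈-only v)

  N⊆B : ∀ v → N v ⊆ B v
  N⊆B v x x∈N = trans (cong (only v x ∨_) x∈N) (∨-zeroʳ (only v x))

  B⇒N : ∀ {v x} → x ∈ B v → v ≢ x → x ∈ N v
  B⇒N {v} {x} x∈B v≢x = trans (cong (_∨ N v x) (sym (∉-only v≢x))) x∈B

  B-sym : ∀ {v x} → x ∈ B v → v ∈ B x
  B-sym {v} {x} x∈B with v ≟ x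
  ... | yes refl = B-centre v
  ... | no _     = N⊆B x v (N-sym x∈B)

  #B : ∀ {v} → Saturated v → # (B v) ≡ 3 + ρ
  #B {v} sat = ≤-antisym
    (≤-trans (#-remove (B v) v) (s≤s (≤-trans (#-⊆ (B v ∖ only v) (N v) λ x x∈ →
       B⇒N (∧-proj₁ x∈) (∉-only⇒≢ (not-elim (∧-proj₂ {B v x} x∈)))) (≤-reflexive sat))))
    (≤-trans (s≤s (≤-reflexive (sym sat))) (#-add (N v) (B v) v (N⊆B v) (B-centre v) (∉N-self v)))

  inner-≤ : ∀ v a → inner v a ≤ 2 + ρ
  inner-≤ v a = ≤-trans (#-⊆ (N a ∩ B v) (N a) λ _ → ∧-proj₁) (Δ≤ a)

  deficit+inner : ∀ v a → deficit v a + inner v a ≡ 2 + ρ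
  deficit+inner v a = m∸n+n≡m (inner-≤ v a)

  C⊆B : ∀ v → C v ⊆ B v
  C⊆B v x = ∧-proj₁

  C-inner : ∀ {v x} → x ∈ C v → 2 + ρ ≤ inner v x
  C-inner {v} {x} x∈C = ⌊⌋-elim (2 + ρ ≤? inner v x) (∧-proj₂ {B v x} x∈C)

  C-intro : ∀ {v x} → x ∈ B v → 2 + ρ ≤ inner v x → x ∈ C v
  C-intro {v} {x} x∈B h = ∧-intro x∈B (⌊⌋-intro (2 + ρ ≤? inner v x) h)

  C-deficit : ∀ {v x} → x ∈ C v → deficit v x ≡ 0
  C-deficit x∈C = m≤n⇒m∸n≡0 (C-inner x∈C)

  E-deficit : ∀ {v x} → x ∈ E v → 1 ≤ deficit v x
  E-deficit {v} {x} x∈E = m<n⇒0<n∸m (≰⇒> λ h →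
    true≢false (C-intro (∧-proj₁ x∈E) h) (not-elim (∧-proj₂ {B v x} x∈E)))

  C-centre : ∀ {v} → Saturated v → v ∈ C v
  C-centre {v} sat = C-intro (B-centre v) (≤-trans (≤-reflexive (sym sat))
    (#-⊆ (N v) (N v ∩ B v) λ x x∈N → ∧-intro x∈N (N⊆B v x x∈N)))

  -- The r neighbours that `x` has inside `B v` already exhaust its degree.
  C-closed : ∀ {v x} → x ∈ C v → N x ⊆ B v
  C-closed {v} {x} x∈C y y∈N with B v y in e
  ... | true  = refl
  ... | false = contradiction (≤-trans (s≤s (C-inner x∈C)) (≤-trans
      (#-add (N x ∩ B v) (N x) y (λ _ → ∧-proj₁) y∈N (trans (cong (N x y ∧_) e) (∧-zeroʳ (N x y)))) (Δ≤ x)))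
    (<-irrefl refl)

  -- Among the r + 1 vertices of `B v`, the r neighbours of `x` leave room only for `x` itself.
  C-universal : ∀ {v x y} → Saturated v → x ∈ C v → y ∈ B v → x ≢ y → y ∈ N x
  C-universal {v} {x} {y} sat x∈C y∈B x≢y with N x y in e
  ... | true  = refl
  ... | false = contradiction (≤-trans (+-monoʳ-≤ 2 (C-inner x∈C)) (≤-trans
      (#-add₂ (N x ∩ B v) (B v) x y (λ z → ∧-proj₂ {N x z}) (C⊆B v x x∈C) y∈B
         (cong (_∧ B v x) (∉N-self x)) (cong (_∧ B v y) e) x≢y) (≤-reflexive (#B sat))))
    (<-irrefl refl)

  C⇒B⊆ : ∀ {v x} → x ∈ C v → B x ⊆ B v
  C⇒B⊆ {v} {x} x∈C y y∈B with x ≟ y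
  ... | yes refl = C⊆B v x x∈C
  ... | no _     = C-closed x∈C y y∈B

  C⇒⊆B : ∀ {v x} → Saturated v → x ∈ C v → B v ⊆ B x
  C⇒⊆B {v} {x} sat x∈C y y∈B with x ≟ y
  ... | yes refl = refl
  ... | no x≢y   = C-universal sat x∈C y∈B x≢y

  -- A vertex adjacent to all the rest of `B v` would lie in `C v`. The missed vertex is not in
  -- `C v` either, as members of `C v` are adjacent to everything in `B v`.
  E-nonneighbour : ∀ {v a} → Saturated v → a ∈ B v → a ∉ C v → ∃ λ y → y ∈ E v × a ≢ y × y ∉ N a
  E-nonneighbour {v} {a} sat a∈B a∉C with any? (λ y → ((B v ∖ only a) ∖ N a) y Bool.≟ true)
  ... | yes (y , y∈) = y , ∧-intro y∈B (not-intro (¬-not y∉C)) , a≢y , y∉N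
    where
    y∈B∖a : y ∈ B v ∖ only a
    y∈B∖a = ∧-proj₁ {(B v ∖ only a) y} y∈
    y∈B : y ∈ B v
    y∈B = ∧-proj₁ y∈B∖a
    a≢y : a ≢ y
    a≢y = ∉-only⇒≢ (not-elim (∧-proj₂ {B v y} y∈B∖a))
    y∉N : y ∉ N a
    y∉N = not-elim (∧-proj₂ {(B v ∖ only a) y} y∈)
    y∉C : y ∈ C v → ⊥
    y∉C y∈C = true≢false (N-sym (C-universal sat y∈C a∈B (a≢y ∘ sym))) y∉N
  ... | no none = true≢false (C-intro a∈B (≤-pred (begin
    3 + ρ                       ≡⟨ #B sat ⟨
    # (B v)                     ≤⟨ #-remove (B v) a ⟩
    suc (# (B v ∖ only a))      ≤⟨ s≤s (#-⊆ (B v ∖ only a) (N a ∩ B v) λ y y∈ →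
                                     ∧-intro (N-all y y∈) (∧-proj₁ y∈)) ⟩
    suc (inner v a)             ∎))) a∉C
    where
    open ≤-Reasoning
    N-all : ∀ y → y ∈ B v ∖ only a → y ∈ N a
    N-all y y∈ with N a y in e
    ... | true  = refl
    ... | false = contradiction (y , ∧-intro y∈ (not-intro e)) none

  #C+#E : ∀ {v} → Saturated v → # (C v) + # (E v) ≡ 3 + ρ
  #C+#E {v} sat = begin
    # (C v) + # (E v)           ≡⟨ cong (_+ # (E v)) (≤-antisym
                                     (#-⊆ (C v) (B v ∩ C v) λ x x∈ → ∧-intro (C⊆B v x x∈) x∈)
                                     (#-⊆ (B v ∩ C v) (C v) λ x → ∧-proj₂ {B v x})) ⟩
    # (B v ∩ C v) + # (E v)     ≡⟨ #-split (B v) (C v) ⟨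
    # (B v)                     ≡⟨ #B sat ⟩
    3 + ρ                       ∎
    where open ≡-Reasoning

  -- If `E v` were empty, `B v` would be a clique on r + 1 vertices, against the bound on the clique
  -- number. A member of `E v` brings a non-neighbour, also in `E v`.
  2≤#E : ∀ {v} → Saturated v → 2 ≤ # (E v)
  2≤#E {v} sat with any? (λ a → E v a Bool.≟ true)
  ... | yes (a , a∈E) with E-nonneighbour sat (∧-proj₁ a∈E) (not-elim (∧-proj₂ {B v a} a∈E))
  ...   | y , y∈E , a≢y , _ = ≤-trans (+-monoʳ-≤ 2 z≤n)
    (#-add₂ (λ _ → false) (E v) a y (λ _ ()) a∈E y∈E refl refl a≢y)
  2≤#E {v} sat | no none = contradiction (≤-trans (≤-reflexive (sym size)) (ω≤ S clique)) (<-irrefl refl)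
    where
    S : Subset n
    S = Vec.tabulate (B v)
    lookup-S : ∀ x → lookup S x ≡ B v x
    lookup-S = lookup∘tabulate (B v)
    size : ∣ S ∣ ≡ 3 + ρ
    size = trans (∣∣≡#lookup S) (trans (sum-cong-≗ λ x → cong ⟦_⟧ (lookup-S x)) (#B sat))
    all-C : ∀ {x} → x ∈ B v → x ∈ C v
    all-C {x} x∈B with C v x in e
    ... | true  = refl
    ... | false = contradiction (x , ∧-intro x∈B (not-intro e)) none
    clique : IsClique G S
    clique x y x∈S y∈S x≢y = Equivalence.from T-≡
      (C-universal sat (all-C (trans (sym (lookup-S x)) ([]=⇒lookup x∈S)))
        (trans (sym (lookup-S y)) ([]=⇒lookup y∈S)) x≢y)

  #C-≤ : ∀ {v} → Saturated v → # (C v) ≤ 1 + ρ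
  #C-≤ {v} sat = +-cancelʳ-≤ 2 (# (C v)) (1 + ρ) (begin
    # (C v) + 2        ≤⟨ +-monoʳ-≤ (# (C v)) (2≤#E sat) ⟩
    # (C v) + # (E v)  ≡⟨ #C+#E sat ⟩
    3 + ρ              ≡⟨ +-comm 2 (1 + ρ) ⟩
    1 + ρ + 2          ∎)
    where open ≤-Reasoning

  #E≤excess : ∀ v → # (E v) ≤ excess v
  #E≤excess v = sum-mono pointwise
    where
    pointwise : ∀ x → ⟦ E v x ⟧ ≤ ⟦ B v x ⟧ * deficit v x
    pointwise x with E v x in e
    ... | false = z≤n
    ... | true rewrite ∧-proj₁ {B v x} e = ≤-trans (E-deficit e) (≤-reflexive (sym (*-identityˡ _)))

  -- Each vertex of `E v` other than `a` adds at least 1 to the excess; the `suc` pays for `a` being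
  -- counted in `E v` too.
  deficit+#E≤excess : ∀ v {a} → a ∈ B v → deficit v a + # (E v) ≤ suc (excess v)
  deficit+#E≤excess v {a} a∈B = begin
    deficit v a + # (E v)                           ≤⟨ +-monoʳ-≤ (deficit v a) (#-remove (E v) a) ⟩
    deficit v a + suc (# (E v ∖ only a))            ≡⟨ +-suc (deficit v a) _ ⟩
    suc (deficit v a + # (E v ∖ only a))            ≡⟨ cong (λ z → suc (z + # (E v ∖ only a))) (sumIn-only a (deficit v)) ⟨
    suc (sumIn (only a) (deficit v) + # (E v ∖ only a))
      ≤⟨ s≤s (+-mono-≤ (sumIn-⊆ (only a) (B v ∩ only a) λ x x∈ → ∧-intro (subst (_∈ B v) (only⇒≡ x∈) a∈B) x∈)
                       others) ⟩
    suc (sumIn (B v ∩ only a) (deficit v) + sumIn (B v ∖ only a) (deficit v))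
      ≡⟨ cong suc (sumIn-split (B v) (only a) (deficit v)) ⟨
    suc (excess v)                                  ∎
    where
    open ≤-Reasoning
    others : # (E v ∖ only a) ≤ sumIn (B v ∖ only a) (deficit v)
    others = ≤-trans (≤-reflexive (sym (#-sumIn (E v ∖ only a))))
      (≤-trans (sumIn-mono (E v ∖ only a) λ x x∈ → E-deficit (∧-proj₁ {E v x} x∈))
               (sumIn-⊆ (E v ∖ only a) (B v ∖ only a) λ x x∈ →
                  ∧-intro (∧-proj₁ (∧-proj₁ {E v x} x∈)) (∧-proj₂ {E v x} x∈)))

  -- Common neighbours of `x` and `a` lie in `B v` and differ from `x`, so there are at most r - 1 -
  -- s_a of them. Summing over `N x`, which contains all of `B v` except `x`, loses the whole
  -- excess, as `x` has deficit 0.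
  common-C : ∀ {v x} → Saturated v → x ∈ C v → common x + excess v ≤ (2 + ρ) * (1 + ρ)
  common-C {v} {x} sat x∈C = begin
    common x + excess v                              ≤⟨ +-monoʳ-≤ (common x) (sum-mono excess-N) ⟩
    common x + sumIn (N x) (deficit v)               ≡⟨ sumIn-+ (N x) _ _ ⟨
    sumIn (N x) (λ a → # (N x ∩ N a) + deficit v a)  ≤⟨ sumIn-mono (N x) pointwise ⟩
    sumIn (N x) (λ _ → 1 + ρ)                        ≡⟨ sumIn-const (N x) _ ⟩
    # (N x) * (1 + ρ)                                ≤⟨ *-monoˡ-≤ (1 + ρ) (Δ≤ x) ⟩
    (2 + ρ) * (1 + ρ)                                ∎
    where
    open ≤-Reasoning
    excess-N : ∀ y → ⟦ B v y ⟧ * deficit v y ≤ ⟦ N x y ⟧ * deficit v y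
    excess-N y with B v y in e
    ... | false = z≤n
    ... | true with x ≟ y
    ...   | yes refl = ≤-trans (≤-reflexive (trans (*-identityˡ _) (C-deficit x∈C))) z≤n
    ...   | no x≢y rewrite C-universal sat x∈C e x≢y = ≤-refl
    pointwise : ∀ a → a ∈ N x → # (N x ∩ N a) + deficit v a ≤ 1 + ρ
    pointwise a a∈N = ≤-pred (begin
      suc (# (N x ∩ N a)) + deficit v a
        ≤⟨ +-monoˡ-≤ _ (#-add (N x ∩ N a) (N a ∩ B v) x
             (λ y y∈ → ∧-intro (∧-proj₂ {N x y} y∈) (C-closed x∈C y (∧-proj₁ y∈)))
             (∧-intro (N-sym a∈N) (C⊆B v x x∈C)) (cong (_∧ N a x) (∉N-self x))) ⟩
      inner v a + deficit v a           ≡⟨ +-comm (inner v a) _ ⟩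
      deficit v a + inner v a           ≡⟨ deficit+inner v a ⟩
      2 + ρ                             ∎)

  -- One share |C| s_a is lost at the neighbours of `a` in `C v`. The other comes from the s_a
  -- places that `a` does not fill inside `B v`: each is a neighbour outside `B v`, not adjacent to
  -- `C v`, or a missing unit of degree.
  common-E : ∀ {v a} → Saturated v → a ∈ B v → a ∉ C v →
    common a + 2 * (# (C v) * deficit v a) ≤ (2 + ρ) * (1 + ρ)
  common-E {v} {a} sat a∈B a∉C = final
    where
    open ≤-Reasoning
    c s i o : ℕ
    c = # (C v)
    s = deficit v a
    i = inner v a
    o = # (N a ∖ B v)
    C⊆N : C v ⊆ N a
    C⊆N x x∈C = N-sym (C-universal sat x∈C a∈B λ { refl → true≢false x∈C a∉C })
    notB : BSet n
    notB x = not (B v x)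
    -- A neighbour `u` in `C v` sees only `B v`, which costs `s`; one outside `B v` is adjacent to
    -- none of `C v`, although `C v` lies in `N a`, which costs `c`; the remaining ones get the
    -- trivial bound r - 1.
    pointwise : ∀ u → u ∈ N a → ∀ inC inB → C v u ≡ inC → B v u ≡ inB →
      # (N a ∩ N u) + (⟦ inC ⟧ * s + ⟦ not inB ⟧ * c) ≤ 1 + ρ
    pointwise u u∈N true  false e₁ e₂ = true≢false (C⊆B v u e₁) e₂
    pointwise u u∈N true  true  e₁ e₂ = ≤-pred (begin
      suc (# (N a ∩ N u) + (1 * s + 0))  ≡⟨ cong (λ z → suc (# (N a ∩ N u) + z)) (trans (+-identityʳ _) (*-identityˡ s)) ⟩
      suc (# (N a ∩ N u)) + s            ≤⟨ +-monoˡ-≤ s (#-add (N a ∩ N u) (N a ∩ B v) u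
                                              (λ y y∈ → ∧-intro (∧-proj₁ y∈) (C-closed e₁ y (∧-proj₂ {N a y} y∈)))
                                              (∧-intro u∈N e₂) u∉) ⟩
      i + s                              ≡⟨ +-comm i s ⟩
      s + i                              ≡⟨ deficit+inner v a ⟩
      2 + ρ                              ∎)
      where
      u∉ : u ∉ N a ∩ N u
      u∉ = trans (cong (N a u ∧_) (∉N-self u)) (∧-zeroʳ (N a u))
    pointwise u u∈N false true  e₁ e₂ = ≤-pred (begin
      suc (# (N a ∩ N u) + 0)            ≡⟨ cong suc (+-identityʳ _) ⟩
      suc (# (N a ∩ N u))                ≤⟨ #-∩adj G (N a) u∈N ⟩
      # (N a)                            ≤⟨ Δ≤ a ⟩
      2 + ρ                              ∎)
    pointwise u u∈N false false e₁ e₂ = ≤-pred (begin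
      suc (# (N a ∩ N u) + 1 * c)        ≡⟨ cong (λ z → suc (# (N a ∩ N u) + z)) (*-identityˡ c) ⟩
      suc (# (N a ∩ N u) + c)            ≤⟨ s≤s (#-disjoint (N a ∩ N u) (C v) (N a ∖ only u)
                                              (λ y y∈ → ∧-intro (∧-proj₁ {N a y} y∈) (not-intro (∉-only λ { refl →
                                                 true≢false (∧-proj₂ {N a u} y∈) (∉N-self u) })))
                                              (λ y y∈C → ∧-intro (C⊆N y y∈C) (not-intro (∉-only λ { refl →
                                                 true≢false y∈C e₁ })))
                                              λ y y∈ → ¬-not λ y∈C →
                                                 true≢false (C-closed y∈C u (N-sym (∧-proj₂ {N a y} y∈))) e₂) ⟩
      suc (# (N a ∖ only u))             ≤⟨ #-add (N a ∖ only u) (N a) u (λ _ → ∧-proj₁) u∈N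
                                              (trans (cong (λ b → N a u ∧ not b) (∈-only u)) (∧-zeroʳ (N a u))) ⟩
      # (N a)                            ≤⟨ Δ≤ a ⟩
      2 + ρ                              ∎)
    c≤ : c ≤ # (N a ∩ C v)
    c≤ = #-⊆ (C v) (N a ∩ C v) λ x x∈C → ∧-intro (C⊆N x x∈C) x∈C
    summed : common a + (c * s + o * c) ≤ (i + o) * (1 + ρ)
    summed = begin
      common a + (c * s + o * c)
        ≤⟨ +-monoʳ-≤ (common a) (+-monoˡ-≤ (o * c) (*-monoˡ-≤ s c≤)) ⟩
      common a + (# (N a ∩ C v) * s + # (N a ∩ notB) * c)
        ≡⟨ cong (common a +_) (trans (sumIn-+ (N a) _ _) (cong₂ _+_ (sumIn-⟦⟧ (N a) (C v) s) (sumIn-⟦⟧ (N a) notB c))) ⟨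
      common a + sumIn (N a) (λ u → ⟦ C v u ⟧ * s + ⟦ notB u ⟧ * c)
        ≡⟨ sumIn-+ (N a) _ _ ⟨
      sumIn (N a) (λ u → # (N a ∩ N u) + (⟦ C v u ⟧ * s + ⟦ notB u ⟧ * c))
        ≤⟨ sumIn-mono (N a) (λ u u∈N → pointwise u u∈N _ _ refl refl) ⟩
      sumIn (N a) (λ _ → 1 + ρ)
        ≡⟨ sumIn-const (N a) _ ⟩
      # (N a) * (1 + ρ)
        ≡⟨ cong (_* (1 + ρ)) (#-split (N a) (B v)) ⟩
      (i + o) * (1 + ρ)
        ∎
    o≤s : o ≤ s
    o≤s = +-cancelʳ-≤ i o s (begin
      o + i      ≡⟨ +-comm o i ⟩
      i + o      ≡⟨ #-split (N a) (B v) ⟨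
      # (N a)    ≤⟨ Δ≤ a ⟩
      2 + ρ      ≡⟨ deficit+inner v a ⟨
      s + i      ∎)
    -- This is r minus the degree of `a`. Each missing neighbour saves r - 1, which is at least `c`
    -- by `#C-≤`.
    d : ℕ
    d = s ∸ o
    s≡ : s ≡ o + d
    s≡ = sym (m+[n∸m]≡n o≤s)
    regroup₁ : ∀ f c o s d → f + (c * s + c * (o + d)) ≡ (f + (c * s + o * c)) + d * c
    regroup₁ = solve-∀
    regroup₂ : ∀ i o d p → (i + o) * p + d * p ≡ (o + d + i) * p
    regroup₂ = solve-∀
    double : ∀ x → 2 * x ≡ x + x
    double = solve-∀
    final : common a + 2 * (c * s) ≤ (2 + ρ) * (1 + ρ)
    final = begin
      common a + 2 * (c * s)                        ≡⟨ cong (common a +_) (double (c * s)) ⟩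
      common a + (c * s + c * s)                    ≡⟨ cong (λ z → common a + (c * s + c * z)) s≡ ⟩
      common a + (c * s + c * (o + d))              ≡⟨ regroup₁ (common a) c o s d ⟩
      (common a + (c * s + o * c)) + d * c          ≤⟨ +-mono-≤ summed (*-monoʳ-≤ d (#C-≤ sat)) ⟩
      (i + o) * (1 + ρ) + d * (1 + ρ)               ≡⟨ regroup₂ i o d (1 + ρ) ⟩
      (o + d + i) * (1 + ρ)                         ≡⟨ cong (λ z → (z + i) * (1 + ρ)) s≡ ⟨
      (s + i) * (1 + ρ)                             ≡⟨ cong (_* (1 + ρ)) (deficit+inner v a) ⟩
      (2 + ρ) * (1 + ρ)                             ∎

  module _ {v w a} (sat-w : Saturated w) (w∉B : w ∉ B v) (a∈Bv : a ∈ B v) (a∈Bw : a ∈ B w) where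

    -- Otherwise `B a`, which contains `w`, would lie in `B v`.
    shared∉C : a ∉ C v
    shared∉C = ¬-not λ a∈C → true≢false (C⇒B⊆ a∈C w (B-sym a∈Bw)) w∉B

    -- All of `C w` is adjacent to `a`, and it avoids `B v`: a common vertex would put `v` into
    -- `B w`. So the neighbours of `a` in `B v` and the class `C w` share the degree of `a`.
    inner+#C≤ : a ∉ C w → inner v a + # (C w) ≤ 2 + ρ
    inner+#C≤ a∉Cw = ≤-trans
      (#-disjoint (N a ∩ B v) (C w) (N a) (λ _ → ∧-proj₁)
        (λ x x∈C → N-sym (C-universal sat-w x∈C a∈Bw λ { refl → true≢false x∈C a∉Cw }))
        (λ x x∈ → ¬-not λ x∈C → true≢false
          (B-sym (C⇒B⊆ x∈C v (B-sym (∧-proj₂ {N a x} x∈)))) w∉B))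
      (Δ≤ a)

  saturated? : ∀ v → Dec (Saturated v)
  saturated? v = # (N v) ℕ.≟ 2 + ρ

  unsaturated-≤ : ∀ {v} → ¬ Saturated v → # (N v) ≤ 1 + ρ
  unsaturated-≤ {v} ¬sat = ≤-pred (≤∧≢⇒< (Δ≤ v) ¬sat)

  inner≥#C : ∀ {v a} → Saturated v → a ∈ B v → a ∉ C v → # (C v) ≤ inner v a
  inner≥#C {v} {a} sat a∈B a∉C = #-⊆ (C v) (N a ∩ B v) λ x x∈C →
    ∧-intro (N-sym (C-universal sat x∈C a∈B λ { refl → true≢false x∈C a∉C })) (C⊆B v x x∈C)

  -- Triangles

  -- The vertices of degree r whose excess is below the average loss 6(r - 1)/(r + 1); only these
  -- can lie above the target for triangles.
  manyTriangles : BSet n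
  manyTriangles v = ⌊ saturated? v ⌋ ∧ ⌊ (3 + ρ) * excess v <? 6 * (1 + ρ) ⌋

  manyTriangles⇒ : ∀ {v} → v ∈ manyTriangles → Saturated v × (3 + ρ) * excess v < 6 * (1 + ρ)
  manyTriangles⇒ {v} h = ⌊⌋-elim (saturated? v) (∧-proj₁ h)
    , ⌊⌋-elim ((3 + ρ) * excess v <? 6 * (1 + ρ)) (∧-proj₂ {⌊ saturated? v ⌋} h)

  -- The number (r - 1)(r - 2)(r + 3) of ordered triangles in K_{r+1} minus an edge: of the (r +
  -- 1)r(r - 1) in K_{r+1}, the edge destroys 6(r - 1).
  triangleBound : ℕ
  triangleBound = (1 + ρ) * (ρ * (5 + ρ))

  triangleBound-≡ : triangleBound + 6 * (1 + ρ) ≡ (3 + ρ) * ((2 + ρ) * (1 + ρ))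
  triangleBound-≡ = identity ρ
    where
    identity : ∀ ρ → (1 + ρ) * (ρ * (5 + ρ)) + 6 * (1 + ρ) ≡ (3 + ρ) * ((2 + ρ) * (1 + ρ))
    identity = solve-∀

  -- A shared vertex `a` spends at least |C w| of its degree outside `B v`, and symmetrically. With
  -- `deficit+#E≤excess` the two excesses then sum to at least 2r, too much for both to be below
  -- average.
  many-disjoint : ∀ v w → v ∈ manyTriangles → w ∈ manyTriangles → w ∉ B v → Disjoint (B v) (B w)
  many-disjoint v w v∈ w∈ w∉B a a∈Bv = ¬-not λ a∈Bw →
    let sat-v , few-v = manyTriangles⇒ v∈
        sat-w , few-w = manyTriangles⇒ w∈
        v∉B = ¬-not λ v∈B → true≢false (B-sym v∈B) w∉B
    in overfull (# (C v)) (# (C w)) few-v few-w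
         (one sat-w w∉B a∈Bv a∈Bw (shared∉C sat-v v∉B a∈Bw a∈Bv))
         (one sat-v v∉B a∈Bw a∈Bv (shared∉C sat-w w∉B a∈Bv a∈Bw))
         (#C+#E sat-v) (#C+#E sat-w)
    where
    open ≤-Reasoning
    one : ∀ {v w} → Saturated w → w ∉ B v → a ∈ B v → a ∈ B w → a ∉ C w →
      # (C w) + # (E v) ≤ suc (excess v)
    one {v} {w} sat-w w∉B a∈Bv a∈Bw a∉Cw = begin
      # (C w) + # (E v)        ≤⟨ +-monoˡ-≤ (# (E v)) #C≤deficit ⟩
      deficit v a + # (E v)    ≤⟨ deficit+#E≤excess v a∈Bv ⟩
      suc (excess v)           ∎
      where
      #C≤deficit : # (C w) ≤ deficit v a
      #C≤deficit = +-cancelʳ-≤ (inner v a) (# (C w)) (deficit v a) (begin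
        # (C w) + inner v a      ≡⟨ +-comm (# (C w)) _ ⟩
        inner v a + # (C w)      ≤⟨ inner+#C≤ sat-w w∉B a∈Bv a∈Bw a∉Cw ⟩
        2 + ρ                    ≡⟨ deficit+inner v a ⟨
        deficit v a + inner v a  ∎)
    overfull : ∀ cv cw {ev ew xv xw} → (3 + ρ) * xv < 6 * (1 + ρ) → (3 + ρ) * xw < 6 * (1 + ρ) →
      cw + ev ≤ suc xv → cv + ew ≤ suc xw → cv + ev ≡ 3 + ρ → cw + ew ≡ 3 + ρ → ⊥
    overfull cv cw {ev} {ew} {xv} {xw} few-v few-w h₁ h₂ e₁ e₂ = <-irrefl refl (begin-strict
      6 * (1 + ρ) + 6 * (1 + ρ)         ≡⟨ expand ρ ⟩
      -- In terms of r: 2r(r + 1) - 12(r - 1) = 2(r - 2)(r - 3), which is non-negative for every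
      -- integer r.
      12 + 10 * ρ + 2 * ρ               ≤⟨ +-monoʳ-≤ (12 + 10 * ρ) (*-monoʳ-≤ 2 (m≤m*m ρ)) ⟩
      12 + 10 * ρ + 2 * (ρ * ρ)         ≡⟨ factor ρ ⟩
      (3 + ρ) * (4 + 2 * ρ)             ≤⟨ *-monoʳ-≤ (3 + ρ) (≤-pred (≤-pred enough)) ⟩
      (3 + ρ) * (xv + xw)               ≡⟨ *-distribˡ-+ (3 + ρ) xv xw ⟩
      (3 + ρ) * xv + (3 + ρ) * xw       <⟨ +-mono-< few-v few-w ⟩
      6 * (1 + ρ) + 6 * (1 + ρ)         ∎)
      where
      expand : ∀ ρ → 6 * (1 + ρ) + 6 * (1 + ρ) ≡ 12 + 10 * ρ + 2 * ρ
      expand = solve-∀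
      factor : ∀ ρ → 12 + 10 * ρ + 2 * (ρ * ρ) ≡ (3 + ρ) * (4 + 2 * ρ)
      factor = solve-∀
      two : ∀ ρ → 6 + 2 * ρ ≡ 3 + ρ + (3 + ρ)
      two = solve-∀
      regroup : ∀ cv ev cw ew → cv + ev + (cw + ew) ≡ cw + ev + (cv + ew)
      regroup = solve-∀
      enough : 6 + 2 * ρ ≤ 2 + (xv + xw)
      enough = begin
        6 + 2 * ρ                 ≡⟨ two ρ ⟩
        3 + ρ + (3 + ρ)           ≡⟨ cong₂ _+_ e₁ e₂ ⟨
        cv + ev + (cw + ew)       ≡⟨ regroup cv ev cw ew ⟩
        cw + ev + (cv + ew)       ≤⟨ +-mono-≤ h₁ h₂ ⟩
        suc xv + suc xw           ≡⟨ cong suc (+-suc xv xw) ⟩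
        2 + (xv + xw)             ∎

  -- The excess is at least e = |E|, and c + e = r + 1 for c = |C|, with e at least 2. A class of
  -- one vertex would force too large an excess, and from c = 2 on the product c e is large enough.
  manyTriangles-product : ∀ {v} → v ∈ manyTriangles → 2 * (1 + ρ) ≤ # (C v) * excess v
  manyTriangles-product {v} v∈ = let sat , few = manyTriangles⇒ v∈ in
    product ρ (# (C v)) (#C+#E sat) (∈⇒1≤# (C v) (C-centre sat)) (2≤#E sat) (#E≤excess v) few
    where
    open ≤-Reasoning
    product : ∀ ρ c {e x} → c + e ≡ 3 + ρ → 1 ≤ c → 2 ≤ e → e ≤ x → (3 + ρ) * x < 6 * (1 + ρ) →
      2 * (1 + ρ) ≤ c * x
    product ρ zero _ () _ _ _
    -- With c = 1 the excess is at least r, and r(r + 1) - 6(r - 1) = (r - 2)(r - 3) is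
    -- non-negative, so the excess is not below average.
    product ρ (suc zero) {x = x} refl _ _ e≤x few = contradiction few (≤⇒≯ (begin
      6 * (1 + ρ)              ≡⟨ expand ρ ⟩
      6 + 5 * ρ + ρ            ≤⟨ +-monoʳ-≤ (6 + 5 * ρ) (m≤m*m ρ) ⟩
      6 + 5 * ρ + ρ * ρ        ≡⟨ factor ρ ⟩
      (3 + ρ) * (2 + ρ)        ≤⟨ *-monoʳ-≤ (3 + ρ) e≤x ⟩
      (3 + ρ) * x              ∎))
      where
      expand : ∀ ρ → 6 * (1 + ρ) ≡ 6 + 5 * ρ + ρ
      expand = solve-∀
      factor : ∀ ρ → 6 + 5 * ρ + ρ * ρ ≡ (3 + ρ) * (2 + ρ)
      factor = solve-∀
    -- In the original sizes this is (c - 2)(e - 2) ≥ 0.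
    product ρ (suc (suc c)) {suc (suc e)} {x} eq _ _ e≤x _ = begin
      2 * (1 + ρ)                ≡⟨ cong (2 *_) (suc-injective (suc-injective eq)) ⟨
      2 * (c + (2 + e))          ≤⟨ m≤m+n _ (c * e) ⟩
      2 * (c + (2 + e)) + c * e  ≡⟨ factor c e ⟩
      (2 + c) * (2 + e)          ≤⟨ *-monoʳ-≤ (2 + c) e≤x ⟩
      (2 + c) * x                ∎
      where
      factor : ∀ c e → 2 * (c + (2 + e)) + c * e ≡ (2 + c) * (2 + e)
      factor = solve-∀
    product ρ (suc (suc c)) {suc zero} eq _ (s≤s ()) _ _

  -- The members of `C v` lose |C| σ together by `common-C`, and those of `E v` lose 2|C| σ by
  -- `common-E`, because the deficits sum to σ.
  common-B : ∀ {v} → Saturated v →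
    sumIn (B v) common + 3 * (# (C v) * excess v) ≤ (3 + ρ) * ((2 + ρ) * (1 + ρ))
  common-B {v} sat = begin
    sumIn (B v) common + 3 * (c * excess v)
      ≡⟨ cong (sumIn (B v) common +_) (regroup c (excess v)) ⟩
    sumIn (B v) common + (c * excess v + 2 * c * excess v)
      ≤⟨ +-monoʳ-≤ (sumIn (B v) common) (+-monoˡ-≤ (2 * c * excess v) (*-monoˡ-≤ (excess v) (#-⊆ (C v) (B v ∩ C v) λ x x∈C → ∧-intro (C⊆B v x x∈C) x∈C))) ⟩
    sumIn (B v) common + (# (B v ∩ C v) * excess v + 2 * c * excess v)
      ≡⟨ cong (sumIn (B v) common +_) (trans (sumIn-+ (B v) _ _)
           (cong₂ _+_ (sumIn-⟦⟧ (B v) (C v) (excess v)) (sumIn-* (B v) (2 * c) (deficit v)))) ⟨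
    sumIn (B v) common + sumIn (B v) (λ u → ⟦ C v u ⟧ * excess v + 2 * c * deficit v u)
      ≡⟨ sumIn-+ (B v) _ _ ⟨
    sumIn (B v) (λ u → common u + (⟦ C v u ⟧ * excess v + 2 * c * deficit v u))
      ≤⟨ sumIn-mono (B v) (λ u u∈B → pointwise u u∈B _ refl) ⟩
    sumIn (B v) (λ _ → (2 + ρ) * (1 + ρ))
      ≡⟨ trans (sumIn-const (B v) _) (cong (_* ((2 + ρ) * (1 + ρ))) (#B sat)) ⟩
    (3 + ρ) * ((2 + ρ) * (1 + ρ))
      ∎
    where
    open ≤-Reasoning
    c : ℕ
    c = # (C v)
    regroup : ∀ c x → 3 * (c * x) ≡ c * x + 2 * c * x
    regroup = solve-∀
    pointwise : ∀ u → u ∈ B v → ∀ inC → C v u ≡ inC →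
      common u + (⟦ inC ⟧ * excess v + 2 * c * deficit v u) ≤ (2 + ρ) * (1 + ρ)
    pointwise u u∈B true u∈C = begin
      common u + (1 * excess v + 2 * c * deficit v u)
        ≡⟨ cong (common u +_) (cong₂ _+_ (*-identityˡ _) (trans (cong (2 * c *_) (C-deficit u∈C)) (*-zeroʳ (2 * c)))) ⟩
      common u + (excess v + 0)
        ≡⟨ cong (common u +_) (+-identityʳ _) ⟩
      common u + excess v
        ≤⟨ common-C sat u∈C ⟩
      (2 + ρ) * (1 + ρ)
        ∎
    pointwise u u∈B false u∉C =
      ≤-trans (≤-reflexive (cong (common u +_) (*-assoc 2 c _))) (common-E sat u∈B u∉C)

  -- Discharging with all counts multiplied by r + 1. A vertex of degree below r has few ordered
  -- edges in its neighbourhood, one with large excess is settled by `common-C`, and the others are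
  -- averaged over `B v`.
  triangles-≤ : (3 + ρ) * sum common ≤ n * triangleBound
  triangles-≤ = begin
    (3 + ρ) * sum common            ≡⟨ *-distribˡ-sum (3 + ρ) common ⟩
    sum (λ v → (3 + ρ) * common v)  ≤⟨ discharge B manyTriangles (λ v → (3 + ρ) * common v) triangleBound
                                         B-centre few-≤ many-≤ many-disjoint ⟩
    n * triangleBound               ∎
    where
    open ≤-Reasoning
    few-≤ : ∀ v → v ∉ manyTriangles → (3 + ρ) * common v ≤ triangleBound
    few-≤ v v∉ with saturated? v
    ... | no ¬sat = begin
      (3 + ρ) * common v                 ≤⟨ *-monoʳ-≤ (3 + ρ) common≤ ⟩
      (3 + ρ) * ((1 + ρ) * ρ)            ≤⟨ m≤m+n _ (2 * ((1 + ρ) * ρ)) ⟩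
      (3 + ρ) * ((1 + ρ) * ρ) + 2 * ((1 + ρ) * ρ)
                                         ≡⟨ factor ρ ⟩
      triangleBound                      ∎
      where
      factor : ∀ ρ → (3 + ρ) * ((1 + ρ) * ρ) + 2 * ((1 + ρ) * ρ) ≡ (1 + ρ) * (ρ * (5 + ρ))
      factor = solve-∀
      common≤ : common v ≤ (1 + ρ) * ρ
      common≤ = begin
        common v               ≤⟨ sumIn-mono (N v) (λ u u∈N → ≤-pred (≤-trans (#-∩adj G (N v) u∈N) (unsaturated-≤ ¬sat))) ⟩
        sumIn (N v) (λ _ → ρ)  ≡⟨ sumIn-const (N v) ρ ⟩
        # (N v) * ρ            ≤⟨ *-monoˡ-≤ ρ (unsaturated-≤ ¬sat) ⟩
        (1 + ρ) * ρ            ∎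
    ... | yes sat with (3 + ρ) * excess v <? 6 * (1 + ρ)
    ...   | no ≮ = +-cancelʳ-≤ (6 * (1 + ρ)) _ _ (begin
      (3 + ρ) * common v + 6 * (1 + ρ)          ≤⟨ +-monoʳ-≤ _ (≮⇒≥ ≮) ⟩
      (3 + ρ) * common v + (3 + ρ) * excess v   ≡⟨ *-distribˡ-+ (3 + ρ) (common v) _ ⟨
      (3 + ρ) * (common v + excess v)           ≤⟨ *-monoʳ-≤ (3 + ρ) (common-C sat (C-centre sat)) ⟩
      (3 + ρ) * ((2 + ρ) * (1 + ρ))             ≡⟨ triangleBound-≡ ⟨
      triangleBound + 6 * (1 + ρ)               ∎)
    few-≤ v () | yes sat | yes _
    many-≤ : ∀ v → v ∈ manyTriangles → sumIn (B v) (λ u → (3 + ρ) * common u) ≤ # (B v) * triangleBound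
    many-≤ v v∈ = begin
      sumIn (B v) (λ u → (3 + ρ) * common u)   ≡⟨ sumIn-* (B v) (3 + ρ) common ⟩
      (3 + ρ) * sumIn (B v) common             ≤⟨ *-monoʳ-≤ (3 + ρ) (+-cancelʳ-≤ (6 * (1 + ρ)) _ _ (begin
          sumIn (B v) common + 6 * (1 + ρ)                ≡⟨ cong (sumIn (B v) common +_) (*-assoc 3 2 (1 + ρ)) ⟩
          sumIn (B v) common + 3 * (2 * (1 + ρ))          ≤⟨ +-monoʳ-≤ _ (*-monoʳ-≤ 3 (manyTriangles-product v∈)) ⟩
          sumIn (B v) common + 3 * (# (C v) * excess v)   ≤⟨ common-B sat ⟩
          (3 + ρ) * ((2 + ρ) * (1 + ρ))                   ≡⟨ triangleBound-≡ ⟨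
          triangleBound + 6 * (1 + ρ)                     ∎)) ⟩
      (3 + ρ) * triangleBound                  ≡⟨ cong (_* triangleBound) (#B sat) ⟨
      # (B v) * triangleBound                  ∎
      where
      sat : Saturated v
      sat = proj₁ (manyTriangles⇒ v∈)

  -- Larger cliques

  -- The number of other vertices with the same closed neighbourhood, if that has size r + 1.
  twins : Fin n → ℕ
  twins v = ⟦ ⌊ saturated? v ⌋ ⟧ * (# (C v) ∸ 1)

  -- The classes of the maximal size r - 1 allowed by `#C-≤`.
  largeC : BSet n
  largeC v = ⌊ saturated? v ⌋ ∧ ⌊ # (C v) ℕ.≟ 1 + ρ ⌋

  largeC⇒ : ∀ {v} → v ∈ largeC → Saturated v × # (C v) ≡ 1 + ρ
  largeC⇒ {v} h = ⌊⌋-elim (saturated? v) (∧-proj₁ h)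
    , ⌊⌋-elim (# (C v) ℕ.≟ 1 + ρ) (∧-proj₂ {⌊ saturated? v ⌋} h)

  twins-≤ : ∀ v → twins v ≤ ρ
  twins-≤ v with saturated? v
  ... | yes sat = ≤-trans (≤-reflexive (*-identityˡ _)) (∸-monoˡ-≤ 1 (#C-≤ sat))
  ... | no _    = z≤n

  -- Here `E v` consists of `a` and a non-neighbour `y` only. A twin `x` of `a` lies in `B v`: in
  -- `C v` it would be adjacent to `y`, making `a` adjacent to `y` as well, and in `E v` it would be
  -- a third element.
  twins-outside-largeC : ∀ {v a} → v ∈ largeC → a ∈ B v → a ∉ C v → twins a ≡ 0
  twins-outside-largeC {v} {a} v∈ a∈B a∉C with saturated? a
  ... | no _      = refl
  ... | yes sat-a = trans (*-identityˡ _) (m≤n⇒m∸n≡0 (≤-trans (#-⊆ (C a) (only a) C⊆only) (≤-reflexive (#-only a))))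
    where
    sat-v : Saturated v
    sat-v = proj₁ (largeC⇒ v∈)
    #E≡2 : # (E v) ≡ 2
    #E≡2 = +-cancelˡ-≡ (1 + ρ) _ _ (trans (cong (_+ # (E v)) (sym (proj₂ (largeC⇒ v∈))))
      (trans (#C+#E sat-v) (+-comm 2 (1 + ρ))))
    no-twin : ∀ x → x ∈ C a → a ≢ x → ⊥
    no-twin x x∈Ca a≢x with E-nonneighbour sat-v a∈B a∉C
    ... | y , y∈E , a≢y , y∉N = split (C v x) refl
      where
      x∈Bv : x ∈ B v
      x∈Bv = B-sym {x} {v} (C⇒⊆B {a} {x} sat-a x∈Ca v (B-sym {v} {a} a∈B))
      x∈N : x ∈ N a
      x∈N = B⇒N {a} {x} (C⊆B a x x∈Ca) a≢x
      a∈E : a ∈ E v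
      a∈E = ∧-intro a∈B (not-intro a∉C)
      split : ∀ inC → C v x ≡ inC → ⊥
      split true x∈Cv = true≢false
        (B⇒N {a} {y} (C⇒B⊆ {a} {x} x∈Ca y (C⇒⊆B {v} {x} sat-v x∈Cv y (∧-proj₁ y∈E))) a≢y) y∉N
      split false x∉Cv = contradiction (≤-trans
        (≤-trans (≤-reflexive (cong (2 +_) (sym (#-only a))))
          (#-add₂ (only a) (E v) x y (λ z z∈ → subst (_∈ E v) (only⇒≡ z∈) a∈E)
            (∧-intro x∈Bv (not-intro x∉Cv)) y∈E (∉-only a≢x) (∉-only a≢y)
            λ { refl → true≢false x∈N y∉N }))
        (≤-reflexive #E≡2)) (<-irrefl refl)
    C⊆only : C a ⊆ only a
    C⊆only x x∈Ca = ¬-not {y = false} λ x∉ → no-twin x x∈Ca (∉-only⇒≢ x∉)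

  module _ (1≤ρ : 1 ≤ ρ) where

    -- A shared vertex would be adjacent to two disjoint classes of size r - 1, but 2(r - 1) > r
    -- once r is at least 3.
    largeC-disjoint : ∀ v w → v ∈ largeC → w ∈ largeC → w ∉ B v → Disjoint (B v) (B w)
    largeC-disjoint v w v∈ w∈ w∉B a a∈Bv = ¬-not λ a∈Bw →
      let sat-v , c-v = largeC⇒ v∈
          sat-w , c-w = largeC⇒ w∈
          v∉B = ¬-not λ v∈B → true≢false (B-sym v∈B) w∉B
          a∉Cv = shared∉C sat-w w∉B a∈Bv a∈Bw
          a∉Cw = shared∉C sat-v v∉B a∈Bw a∈Bv
      in <-irrefl refl (begin-strict
        1 + ρ + 1                 <⟨ +-monoʳ-< (1 + ρ) (s≤s 1≤ρ) ⟩
        1 + ρ + (1 + ρ)           ≡⟨ cong₂ _+_ c-v c-w ⟨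
        # (C v) + # (C w)         ≤⟨ +-monoˡ-≤ _ (inner≥#C sat-v a∈Bv a∉Cv) ⟩
        inner v a + # (C w)       ≤⟨ inner+#C≤ sat-w w∉B a∈Bv a∈Bw a∉Cw ⟩
        2 + ρ                     ≡⟨ +-comm 1 (1 + ρ) ⟩
        1 + ρ + 1                 ∎)
      where open ≤-Reasoning

    -- A class of size r - 1 meets the average exactly over `B v`, since the two vertices of `E v`
    -- have no twins; every other vertex has at most r - 3 twins and is below the average by `loss`.
    sum-twins↓-≤ : ∀ s → (3 + ρ) * sum (λ v → twins v ↓ (2 + s)) ≤ n * ((1 + ρ) * ρ ↓ (2 + s))
    sum-twins↓-≤ s = begin
      (3 + ρ) * sum (λ v → twins v ↓ (2 + s))    ≡⟨ *-distribˡ-sum {n} (3 + ρ) _ ⟩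
      sum (λ v → (3 + ρ) * twins v ↓ (2 + s))    ≤⟨ discharge B largeC (λ v → (3 + ρ) * twins v ↓ (2 + s)) _
                                                      B-centre small-≤ large-≤ largeC-disjoint ⟩
      n * ((1 + ρ) * ρ ↓ (2 + s))                ∎
      where
      open ≤-Reasoning
      -- The exponent of at least 2 matters: it leaves a factor of at most `p ∸ 1` to compare. For
      -- exponent 1, (4 + p)p ≤ (2 + p)(1 + p) fails as soon as p > 2.
      loss : ∀ ρ → (3 + ρ) * (ρ ∸ 1) ↓ (2 + s) ≤ (1 + ρ) * ρ ↓ (2 + s)
      loss zero    = ≤-reflexive (*-zeroʳ 3)
      loss (suc p) = begin
        (4 + p) * p ↓ (2 + s)                      ≡⟨ cong ((4 + p) *_) (↓-suc p (1 + s)) ⟩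
        (4 + p) * (p ↓ (1 + s) * (p ∸ (1 + s)))    ≤⟨ *-monoʳ-≤ (4 + p) (*-monoʳ-≤ (p ↓ (1 + s)) (∸-monoʳ-≤ p (s≤s z≤n))) ⟩
        (4 + p) * (p ↓ (1 + s) * (p ∸ 1))          ≡⟨ swap (4 + p) (p ↓ (1 + s)) (p ∸ 1) ⟩
        (4 + p) * (p ∸ 1) * p ↓ (1 + s)            ≤⟨ *-monoˡ-≤ (p ↓ (1 + s)) (quadratic p) ⟩
        (2 + p) * (1 + p) * p ↓ (1 + s)            ≡⟨ *-assoc (2 + p) (1 + p) _ ⟩
        (2 + p) * (suc p) ↓ (2 + s)                ∎
        where
        swap : ∀ a b c → a * (b * c) ≡ a * c * b
        swap = solve-∀
        quadratic : ∀ p → (4 + p) * (p ∸ 1) ≤ (2 + p) * (1 + p)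
        quadratic zero    = z≤n
        quadratic (suc p) = ≤-trans (m≤m+n _ 6) (≤-reflexive (expand p))
          where
          expand : ∀ p → (5 + p) * p + 6 ≡ (3 + p) * (2 + p)
          expand = solve-∀
      small-≤ : ∀ v → v ∉ largeC → (3 + ρ) * twins v ↓ (2 + s) ≤ (1 + ρ) * ρ ↓ (2 + s)
      small-≤ v v∉ = ≤-trans (*-monoʳ-≤ (3 + ρ) (↓-monoˡ-≤ (2 + s) (few v∉))) (loss ρ)
        where
        few : v ∉ largeC → twins v ≤ ρ ∸ 1
        few v∉ with saturated? v
        ... | no _ = z≤n
        ... | yes sat with # (C v) ℕ.≟ 1 + ρ
        ...   | no ≢ = ≤-trans (≤-reflexive (*-identityˡ _)) (∸-monoˡ-≤ 1 (≤-pred (≤∧≢⇒< (#C-≤ sat) ≢)))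
        few () | yes _ | yes _
      large-≤ : ∀ v → v ∈ largeC → sumIn (B v) (λ u → (3 + ρ) * twins u ↓ (2 + s))
        ≤ # (B v) * ((1 + ρ) * ρ ↓ (2 + s))
      large-≤ v v∈ = begin
        sumIn (B v) (λ u → (3 + ρ) * twins u ↓ (2 + s))     ≡⟨ sumIn-* (B v) (3 + ρ) _ ⟩
        (3 + ρ) * sumIn (B v) (λ u → twins u ↓ (2 + s))     ≤⟨ *-monoʳ-≤ (3 + ρ) (sumIn-mono (B v) λ u u∈B → pointwise u u∈B _ refl) ⟩
        (3 + ρ) * sumIn (B v) (λ u → ⟦ C v u ⟧ * ρ ↓ (2 + s)) ≡⟨ cong ((3 + ρ) *_) (sumIn-⟦⟧ (B v) (C v) _) ⟩
        (3 + ρ) * (# (B v ∩ C v) * ρ ↓ (2 + s))             ≤⟨ *-monoʳ-≤ (3 + ρ) (*-monoˡ-≤ (ρ ↓ (2 + s))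
                                                                 (#-⊆ (B v ∩ C v) (C v) λ x → ∧-proj₂ {B v x})) ⟩
        (3 + ρ) * (# (C v) * ρ ↓ (2 + s))                   ≡⟨ cong₂ (λ b c → b * (c * ρ ↓ (2 + s)))
                                                                 (sym (#B (proj₁ (largeC⇒ v∈)))) (proj₂ (largeC⇒ v∈)) ⟩
        # (B v) * ((1 + ρ) * ρ ↓ (2 + s))                   ∎
        where
        pointwise : ∀ u → u ∈ B v → ∀ inC → C v u ≡ inC → twins u ↓ (2 + s) ≤ ⟦ inC ⟧ * ρ ↓ (2 + s)
        pointwise u u∈B true  _   = ≤-trans (↓-monoˡ-≤ (2 + s) (twins-≤ u)) (≤-reflexive (sym (*-identityˡ _)))
        pointwise u u∈B false u∉C =
          ≤-reflexive (cong (_↓ (2 + s)) (twins-outside-largeC v∈ u∈B u∉C))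

  -- Induction on the clique size

  W : ℕ → ℕ
  W t = orderedCliques G t full

  -- With first vertex `v` fixed, the rest is extended inside `N v`, where the universal vertices
  -- are those of `C v` other than `v`, that is, its twins. If the degree of `v` is below r, the
  -- plain bound suffices.
  W-suc : ∀ s b → b + suc s ≡ 2 + ρ → W (2 + s) ≤ b * W (suc s) + sum (λ v → twins v ↓ s)
  W-suc s b b+s = begin
    sumIn full (λ v → orderedCliques G (suc s) (N v))
      ≤⟨ sumIn-mono full (λ v _ → pointwise v) ⟩
    sumIn full (λ v → b * orderedCliques G s (N v) + twins v ↓ s)
      ≡⟨ sumIn-+ (full {n}) _ _ ⟩
    sumIn full (λ v → b * orderedCliques G s (N v)) + sumIn full (λ v → twins v ↓ s)
      ≡⟨ cong₂ _+_ (sumIn-* (full {n}) b (λ v → orderedCliques G s (N v))) (sumIn-full (λ v → twins v ↓ s)) ⟩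
    b * W (suc s) + sum (λ v → twins v ↓ s)
      ∎
    where
    open ≤-Reasoning
    size : 2 + ρ ≡ suc (b + s)
    size = trans (sym b+s) (+-suc b s)
    pointwise : ∀ v → orderedCliques G (suc s) (N v) ≤ b * orderedCliques G s (N v) + twins v ↓ s
    pointwise v with saturated? v
    ... | no ¬sat = ≤-trans
      (orderedCliques-suc-≤ G s b (N v) (≤-trans (unsaturated-≤ ¬sat) (≤-reflexive (suc-injective size))))
      (m≤m+n _ _)
    ... | yes sat = ≤-trans
      (orderedCliques-suc-≤-universal G s b (N v) (C v) (≤-trans (Δ≤ v) (≤-reflexive size))
        (λ u x u∈C x∈N → C-universal sat u∈C (N⊆B v x x∈N)) nonneighbour)
      (+-monoʳ-≤ _ (↓-monoˡ-≤ s (≤-trans (∸-monoˡ-≤ 1 fewer) (≤-reflexive (sym (*-identityˡ _))))))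
      where
      fewer : suc (# (N v ∩ C v)) ≤ # (C v)
      fewer = #-add (N v ∩ C v) (C v) v (λ x → ∧-proj₂ {N v x}) (C-centre sat) (cong (_∧ C v v) (∉N-self v))
      nonneighbour : ∀ u → u ∈ N v → u ∉ C v → ∃ λ x → x ∈ N v × u ≢ x × x ∉ N u
      nonneighbour u u∈N u∉C with E-nonneighbour sat (N⊆B v u u∈N) u∉C
      ... | y , y∈E , u≢y , y∉N = y , B⇒N (∧-proj₁ y∈E) (λ { refl → true≢false (N-sym u∈N) y∉N }) , u≢y , y∉N

  -- The base is the triangle bound. The step bounds `W-suc` by `sum-twins↓-≤`, and what results is
  -- n times the recurrence `nearClique-suc`.
  W-≤ : 1 ≤ ρ → ∀ j → 3 + j ≤ 2 + ρ → (3 + ρ) * W (3 + j) ≤ n * nearClique (3 + j) (1 + ρ)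
  W-≤ 1≤ρ zero _ = begin
    (3 + ρ) * W 3          ≡⟨ cong ((3 + ρ) *_) (trans (sumIn-full (λ v → orderedCliques G 2 (N v))) (sum-cong-≗ {n} λ v →
                                sum-cong-≗ {n} λ u → cong (⟦ N v u ⟧ *_) (#-sumIn (N v ∩ N u)))) ⟩
    (3 + ρ) * sum common   ≤⟨ triangles-≤ ⟩
    n * triangleBound      ≡⟨ cong (n *_) (base ρ) ⟩
    n * nearClique 3 (1 + ρ) ∎
    where
    open ≤-Reasoning
    base : ∀ ρ → (1 + ρ) * (ρ * (5 + ρ)) ≡ nearClique 3 (1 + ρ)
    base zero    = refl
    base (suc p) = expand p
      where
      expand : ∀ p → (2 + p) * ((1 + p) * (6 + p))
        ≡ 2 * ((2 + p) * ((1 + p) * 1)) + (2 + p) * (2 * ((1 + p) * 1) + (1 + p) * (2 * 1 + p * 1))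
      expand = solve-∀
  W-≤ 1≤ρ (suc j) 4+j≤ = begin
    (3 + ρ) * W (4 + j)
      ≤⟨ *-monoʳ-≤ (3 + ρ) (W-suc (2 + j) b b+) ⟩
    (3 + ρ) * (b * W (3 + j) + sum (λ v → twins v ↓ (2 + j)))
      ≡⟨ regroup₁ (3 + ρ) b (W (3 + j)) _ ⟩
    b * ((3 + ρ) * W (3 + j)) + (3 + ρ) * sum (λ v → twins v ↓ (2 + j))
      ≤⟨ +-mono-≤ (*-monoʳ-≤ b (W-≤ 1≤ρ j (≤-trans (n≤1+n _) 4+j≤))) (sum-twins↓-≤ 1≤ρ j) ⟩
    b * (n * nearClique (3 + j) (1 + ρ)) + n * (1 + ρ) ↓ (3 + j)
      ≡⟨ regroup₂ b n (nearClique (3 + j) (1 + ρ)) _ ⟩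
    n * (b * nearClique (3 + j) (1 + ρ) + (1 + ρ) ↓ (3 + j))
      ≡⟨ cong (n *_) (nearClique-suc (3 + j) b (1 + ρ) (trans (+-comm (3 + j) b) b+)) ⟨
    n * nearClique (4 + j) (1 + ρ)
      ∎
    where
    open ≤-Reasoning
    b : ℕ
    b = 2 + ρ ∸ (3 + j)
    b+ : b + (3 + j) ≡ 2 + ρ
    b+ = m∸n+n≡m (≤-trans (n≤1+n _) 4+j≤)
    regroup₁ : ∀ r b w t → r * (b * w + t) ≡ b * (r * w) + r * t
    regroup₁ = solve-∀
    regroup₂ : ∀ b n z f → b * (n * z) + n * f ≡ n * (b * z + f)
    regroup₂ = solve-∀

-- The Turán graph T_r(r+1)

module _ (r : ℕ) .{{_ : NonZero r}} where

  private
    T₀ : Graph (suc r)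
    T₀ = turán r (suc r)

    first last : Fin (suc r)
    first = zero
    last  = fromℕ r

    is-last : ∀ {z} → toℕ z ≡ r → z ≡ last
    is-last z≡r = toℕ-injective (trans z≡r (sym (toℕ-fromℕ r)))

  -- Among 0, ..., r only 0 and r are congruent modulo r, so T_r(r+1) lacks a single edge.
  turán-residues : ∀ x y → toℕ x % r ≡ toℕ y % r → x ≢ y →
    (x ≡ first × y ≡ last) ⊎ (x ≡ last × y ≡ first)
  turán-residues x y eq x≢y with toℕ x ℕ.<? r | toℕ y ℕ.<? r
  ... | yes x<r | yes y<r = contradiction
    (toℕ-injective (trans (sym (m<n⇒m%n≡m x<r)) (trans eq (m<n⇒m%n≡m y<r)))) x≢y
  ... | yes x<r | no y≮r = inj₁
    (toℕ-injective (trans (sym (m<n⇒m%n≡m x<r)) (trans eq (trans (cong (_% r) y≡r) (n%n≡0 r)))) , is-last y≡r)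
    where
    y≡r : toℕ y ≡ r
    y≡r = ≤-antisym (toℕ≤pred[n] y) (≮⇒≥ y≮r)
  ... | no x≮r | yes y<r = inj₂
    (is-last x≡r , toℕ-injective (trans (sym (m<n⇒m%n≡m y<r)) (trans (sym eq) (trans (cong (_% r) x≡r) (n%n≡0 r)))))
    where
    x≡r : toℕ x ≡ r
    x≡r = ≤-antisym (toℕ≤pred[n] x) (≮⇒≥ x≮r)
  ... | no x≮r | no y≮r = contradiction
    (toℕ-injective (trans (≤-antisym (toℕ≤pred[n] x) (≮⇒≥ x≮r)) (≤-antisym (≮⇒≥ y≮r) (toℕ≤pred[n] y)))) x≢y

  turán-adjacent : ∀ x y → x ≢ y → ¬ (x ≡ first × y ≡ last) → ¬ (x ≡ last × y ≡ first) → y ∈ adj T₀ x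
  turán-adjacent x y x≢y ¬fl ¬lf with toℕ x % r ≡ᵇ toℕ y % r in e
  ... | false = refl
  ... | true with turán-residues x y (≡ᵇ⇒≡ _ _ (Equivalence.from T-≡ e)) x≢y
  ...   | inj₁ fl = contradiction fl ¬fl
  ...   | inj₂ lf = contradiction lf ¬lf

  turán-nonadjacent : last ∉ adj T₀ first
  turán-nonadjacent = cong not (Equivalence.to T-≡ (≡⇒≡ᵇ (0 % r) (toℕ last % r)
    (trans (m<n⇒m%n≡m (>-nonZero⁻¹ r)) (sym (trans (cong (_% r) (toℕ-fromℕ r)) (n%n≡0 r))))))

  turán-InClass : InClass T₀ r r
  turán-InClass = degree≤ , clique≤
    where
    missing : ∀ P v → v ∉ P → # P ≤ r
    missing P v v∉P = ≤-pred (≤-trans (#-add P full v (λ _ _ → refl) refl v∉P) (≤-reflexive (#-full (suc r))))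
    degree≤ : MaxDegree≤ T₀ r
    degree≤ v = ≤-trans (≤-reflexive (length-filterᵇ-allFin (adj T₀ v))) (missing (adj T₀ v) v (irref T₀ v))
    clique≤ : CliqueNumber≤ T₀ r
    clique≤ S clique with lookup S first in e₁ | lookup S last in e₂
    ... | false | _     = ≤-trans (≤-reflexive (∣∣≡#lookup S)) (missing (lookup S) first e₁)
    ... | true  | false = ≤-trans (≤-reflexive (∣∣≡#lookup S)) (missing (lookup S) last e₂)
    ... | true  | true  = true≢false
      (Equivalence.to T-≡ (clique first last (lookup⇒[]= first S e₁) (lookup⇒[]= last S e₂) first≢last))
      turán-nonadjacent
      where
      first≢last : first ≢ last
      first≢last eq = ≢-nonZero⁻¹ r (sym (trans (cong toℕ eq) (toℕ-fromℕ r)))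

turán-orderedCliques : ∀ ρ t → nearClique t (1 + ρ) ≤ orderedCliques (turán (2 + ρ) (3 + ρ)) t full
turán-orderedCliques ρ t = nearClique≤orderedCliques (turán (2 + ρ) (3 + ρ)) zero (fromℕ (2 + ρ)) (λ ())
  (turán-adjacent (2 + ρ)) t (1 + ρ) full refl refl (≤-reflexive (sym (#-full (3 + ρ))))

-- Clique densities and their supremum

k-≤-turán : ∀ {n} (G : Graph n) ρ j → InClass G (3 + ρ) (3 + ρ) → 3 + j ≤ 3 + ρ →
  k (3 + j) G * (4 + ρ) ≤ k (3 + j) (turán (3 + ρ) (4 + ρ)) * n
k-≤-turán {n} G ρ j (Δ≤ , ω≤) t≤r = *-cancelˡ-≤ (t !) {{t !≢0}} (begin
  t ! * (k t G * (4 + ρ))        ≡⟨ *-assoc (t !) (k t G) _ ⟨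
  t ! * k t G * (4 + ρ)          ≡⟨ trans (*-comm (t ! * k t G) (4 + ρ)) (cong ((4 + ρ) *_) (!*k≡orderedCliques G t)) ⟩
  (4 + ρ) * orderedCliques G t full
    ≤⟨ W-≤ (s≤s z≤n) j t≤r ⟩
  n * nearClique t (2 + ρ)       ≤⟨ *-monoʳ-≤ n (turán-orderedCliques (1 + ρ) t) ⟩
  n * orderedCliques T₀ t full   ≡⟨ trans (cong (n *_) (sym (!*k≡orderedCliques T₀ t))) (*-comm n _) ⟩
  t ! * k t T₀ * n               ≡⟨ *-assoc (t !) (k t T₀) n ⟩
  t ! * (k t T₀ * n)             ∎)
  where
  open ≤-Reasoning
  t : ℕ
  t = 3 + j
  T₀ : Graph (4 + ρ)
  T₀ = turán (3 + ρ) (4 + ρ)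
  -- Here r is `3 + ρ`, so r - 2 is `1 + ρ`, which is positive as `W-≤` requires.
  open Local G (1 + ρ)
    (λ v → ≤-trans (≤-reflexive (sym (length-filterᵇ-allFin (adj G v)))) (Δ≤ v)) ω≤

open import Data.Integer using (+_)

-- Since `_/_` reduces to lowest terms, the cross-multiplied inequality is transported through
-- unnormalised fractions.
/-mono-≤ : ∀ a b c d → a * suc d ≤ b * suc c → + a / suc c ℚ.≤ + b / suc d
/-mono-≤ a b c d h = ℚ.toℚᵘ-cancel-≤
  (ℚᵘ.≤-respˡ-≃ (ℚᵘ.≃-sym (ℚ.toℚᵘ-fromℚᵘ (mkℚᵘ (+ a) c)))
    (ℚᵘ.≤-respʳ-≃ (ℚᵘ.≃-sym (ℚ.toℚᵘ-fromℚᵘ (mkℚᵘ (+ b) d)))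
      (*≤* (subst₂ ℤ._≤_ (ℤ.pos-* a (suc d)) (ℤ.pos-* b (suc c)) (ℤ.+≤+ h)))))

-- As f_t(r,r) is the supremum of ρ_t over the non-empty graphs of the class, the value is stated as
-- their least upper bound. It is attained by the Turán graph, which gives the second half.
theorem4p5 : ∀ (r t : ℕ) .{{_ : NonZero r}} → 3 ≤ t → t ≤ r →
    let v = (+ k t (turán r (suc r))) / suc r in
    ((∀ (m : ℕ) (G : Graph (suc m)) → InClass G r r → (+ k t G) / suc m ℚ.≤ v)
    × (∀ (q : ℚ) → (∀ (m : ℕ) (G : Graph (suc m)) → InClass G r r → (+ k t G) / suc m ℚ.≤ q)
    → v ℚ.≤ q))
theorem4p5 (suc (suc (suc ρ))) (suc (suc (suc j))) _ t≤r =
  (λ m G G∈ → /-mono-≤ (k (3 + j) G) (k (3 + j) (turán (3 + ρ) (4 + ρ))) m (3 + ρ) (k-≤-turán G ρ j G∈ t≤r))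
  , (λ q bound → bound (3 + ρ) (turán (3 + ρ) (4 + ρ)) (turán-InClass (3 + ρ)))
theorem4p5 (suc (suc (suc _))) (suc zero)       (s≤s ())
theorem4p5 (suc (suc (suc _))) (suc (suc zero)) (s≤s (s≤s ()))
theorem4p5 (suc (suc zero)) t 3≤t t≤r = contradiction (≤-trans 3≤t t≤r) λ { (s≤s (s≤s ())) }
theorem4p5 (suc zero) t 3≤t t≤r = contradiction (≤-trans 3≤t t≤r) λ { (s≤s ()) }
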